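{- Let $\mu\subseteq\lambda$ be partitions and $T\in\mathsf{SVT}^m(\lambda/\mu)$. Let $(\widetilde{P},\widetilde{Q})=\mathsf{uncrowd}(T)$ and let $(P,Q)=\tilde\star(\mathsf{res}(T))$. Then $Q=\widetilde{P}$.
   Context: Tableaux are in French notation; cell $(i,j)$ is in row $i$ (from the bottom), column $j$. $\mathsf{SVT}^m(\lambda/\mu)$: fillings of the cells of $\lambda/\mu$ by nonempty subsets of $[m]$ with $\max(A)\leqslant\min(B)$ for horizontally adjacent $A$ left of $B$ and $\max(A)<\min(C)$ for vertically adjacent $A$ below $C$. A multicell is a cell containing more than one entry. Residue map on a set-valued tableau $S$ of shape $\kappa/\rho$ with entries in $[M]$: cell $(i,j)$ has content $\ell(\kappa)+j-i$; $\mathsf{res}(S)=h^M\cdots h^1$, with $h^k$ the decreasing list of contents of cells containing $k$. Uncrowding: the uncrowding operation on a set-valued tableau finds the topmost row $r$ containing a multicell, deletes the largest letter $x$ of row $r$ that lies in a multicell, and inserts $x$ by ordinary RSK row bumping into the rows above row $r$ ($x$ bumps the smallest entry strictly greater than $x$ in the next row up, which is then inserted into the following row, and so on, until a letter is appended at the end of a row). $\mathsf{uncrowd}(T)=(\widetilde{P},\widetilde{Q})$, where $\widetilde{P}$ is the semistandard (single-valued) skew tableau obtained from $T$ by applying uncrowding operations until no multicells remain, and $\widetilde{Q}$ records the added cells (not needed here). $\star$-insertion of a decreasing factorization $h^M\cdots h^1$ whose concatenation is fully-commutative in the 0-Hecke monoid: list pairs (factor index $q$, letter $x$) for the letters of $h^M$,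 then $h^{M-1}$, ..., then $h^1$, in written order, and process them from last to first starting with empty tableaux $P^*,Q^*$: insert $x$ into the bottom row of $P^*$, where inserting $x$ into a row $R$ means: Case 1: if $R$ is empty or $x>\max(R)$, append $x$, add a cell with entry $q$ to $Q^*$ at the same position, stop; Case 2: otherwise if $x\notin R$, replace the smallest $y\in R$ with $y>x$ by $x$ and insert $y$ into the next row up; Case 3: if $x\in R$, leave $R$ unchanged and insert into the next row up the smallest $y\in R$ with $[y,x]\subseteq R$. Modified insertion $\tilde\star$: let $T_\mu$ be the tableau of shape $\mu$ whose row $i$ is filled with $i$'s. Let $T^*$ be the set-valued tableau of shape $\lambda$ obtained by filling the cells of $\mu$ with $T_\mu$ and adding $\ell(\mu)$ to every entry of $T$ in the cells of $\lambda/\mu$ (so $\mathsf{res}(T^*)$ is $\mathsf{res}(T)$ followed by $\mathsf{res}(T_\mu)$, all contents taken in $\lambda$). Let $(P^*,Q^*)$ be the $\star$-insertion of $\mathsf{res}(T^*)$. Then $\tilde\star(\mathsf{res}(T))=(P,Q)$, where $P$ is obtained from $P^*$ by deleting the entries in the cells of $\mu$, and $Q$ is obtained from $Q^*$ by deleting the cells of $\mu$ and decreasing every remaining entry by $\ell(\mu)$. -}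

module Defs where

open import Data.Nat using (ℕ; zero; suc; _+_; _∸_; _≤_; _<_; _<ᵇ_; _≡ᵇ_; _⊔_)
open import Data.Bool using (Bool; true; false; if_then_else_; _∨_; _∧_)
open import Data.List using (List; []; _∷_; _++_; length; map; reverse; foldr; filterᵇ; downFrom; replicate; null; [_])
open import Data.Maybe using (Maybe; just; nothing)
open import Data.Product using (_×_; _,_; ∃; proj₁; proj₂)
open import Data.List.Membership.Propositional using (_∈_)
open import Data.List.Relation.Unary.AllPairs using (AllPairs)
open import Data.List.Relation.Unary.All using (All)
open import Relation.Binary.PropositionalEquality using (_≡_)

-- Conventions: rows and columns are 0-indexed internally; row i (0-indexed)
-- is row i+1 from the bottom (French notation), column j is column j+1.

nthD : {A : Set} → A → List A → ℕ → A
nthD d [] _ = d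
nthD d (x ∷ xs) zero = x
nthD d (x ∷ xs) (suc n) = nthD d xs n

nthM : {A : Set} → List A → ℕ → Maybe A
nthM [] _ = nothing
nthM (x ∷ xs) zero = just x
nthM (x ∷ xs) (suc n) = nthM xs n

memb : ℕ → List ℕ → Bool
memb x [] = false
memb x (y ∷ ys) = (x ≡ᵇ y) ∨ memb x ys

headOr : List ℕ → ℕ
headOr [] = 0
headOr (x ∷ _) = x

lastOf : List ℕ → ℕ
lastOf [] = 0
lastOf (x ∷ []) = x
lastOf (x ∷ y ∷ ys) = lastOf (y ∷ ys)

initOf : List ℕ → List ℕ
initOf [] = []
initOf (x ∷ []) = []
initOf (x ∷ y ∷ ys) = x ∷ initOf (y ∷ ys)

Partition : Set
Partition = List ℕ

IsPartition : Partition → Set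
IsPartition p = All (0 <_) p × AllPairs (λ a b → b ≤ a) p

part : Partition → ℕ → ℕ
part = nthD 0

_⊆ₚ_ : Partition → Partition → Set
mu ⊆ₚ lam = (length mu ≤ length lam) × (∀ i → part mu i ≤ part lam i)

-- Set-valued (skew) tableaux: a list of rows, bottom row first; row i is a
-- list of cells of length λ_i, the first μ_i cells (cells of μ) are
-- 'nothing', the others 'just s' with s the entry set written as a
-- strictly increasing list.

Cell : Set
Cell = Maybe (List ℕ)

Row : Set
Row = List Cell

Tab : Set
Tab = List Row

rowAt : Tab → ℕ → Row
rowAt = nthD []

cellAt : Tab → ℕ → ℕ → Maybe (List ℕ)
cellAt T i j with nthM (rowAt T i) j
... | just c = c
... | nothing = nothing

IsEntrySet : ℕ → List ℕ → Set
IsEntrySet m s = (0 < length s) × AllPairs _<_ s × All (λ a → (1 ≤ a) × (a ≤ m)) s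

record IsSVT (m : ℕ) (lam mu : Partition) (T : Tab) : Set where
  field
    nrows     : length T ≡ length lam
    rowlen    : ∀ i → length (rowAt T i) ≡ part lam i
    inner     : ∀ i j → j < part mu i → cellAt T i j ≡ nothing
    filled    : ∀ i j → part mu i ≤ j → j < part lam i →
                ∃ λ s → (cellAt T i j ≡ just s) × IsEntrySet m s
    rowWeak   : ∀ i j A B → cellAt T i j ≡ just A → cellAt T i (suc j) ≡ just B →
                ∀ a b → a ∈ A → b ∈ B → a ≤ b
    colStrict : ∀ i j A C → cellAt T i j ≡ just A → cellAt T (suc i) j ≡ just C →
                ∀ a c → a ∈ A → c ∈ C → a < c

-- on a reversed row: delete the max of the first (= rightmost) multicell
popRev : List Cell → Maybe (List Cell × ℕ)
popRev [] = nothing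
popRev (just (a ∷ b ∷ s) ∷ cs) = just (just (initOf (a ∷ b ∷ s)) ∷ cs , lastOf (a ∷ b ∷ s))
popRev (c ∷ cs) with popRev cs
... | nothing = nothing
... | just (cs' , x) = just (c ∷ cs' , x)

-- delete the largest letter of the row lying in a multicell
popRow : Row → Maybe (Row × ℕ)
popRow r with popRev (reverse r)
... | nothing = nothing
... | just (r' , x) = just (reverse r' , x)

-- RSK row bumping of x into a (single-valued) row
bumpRow : ℕ → Row → Row × Maybe ℕ
bumpRow x [] = [ just [ x ] ] , nothing
bumpRow x (nothing ∷ cs) with bumpRow x cs
... | cs' , b = nothing ∷ cs' , b
bumpRow x (just s ∷ cs) with x <ᵇ headOr s
... | true = just [ x ] ∷ cs , just (headOr s)
... | false with bumpRow x cs
...   | cs' , b = just s ∷ cs' , b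

insRows : ℕ → Tab → Tab
insRows x [] = [ [ just [ x ] ] ]
insRows x (r ∷ rs) with bumpRow x r
... | r' , nothing = r' ∷ rs
... | r' , just y = r' ∷ insRows y rs

uncrowdStep : Tab → Maybe Tab
uncrowdStep [] = nothing
uncrowdStep (r ∷ rs) with uncrowdStep rs
... | just rs' = just (r ∷ rs')
... | nothing with popRow r
...   | nothing = nothing
...   | just (r' , x) = just (r' ∷ insRows x rs)

uncrowdIter : ℕ → Tab → Tab
uncrowdIter zero T = T
uncrowdIter (suc n) T with uncrowdStep T
... | nothing = T
... | just T' = uncrowdIter n T'

-- total number of letters; each operation decreases the number of
-- letters in multicells, so this many iterations suffice
letters : Tab → ℕ
letters T = foldr (λ r acc → foldr (λ c a → cellSize c + a) acc r) 0 T
  where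
  cellSize : Cell → ℕ
  cellSize nothing = 0
  cellSize (just s) = length s

uncrowdP : Tab → ℕ → ℕ → Maybe ℕ
uncrowdP T i j with cellAt (uncrowdIter (letters T) T) i j
... | nothing = nothing
... | just s = just (headOr s)

-- (content, entry set) of every cell; content of 0-indexed (i,j) is
-- ℓ + (j+1) - (i+1)
rowCells : ℕ → ℕ → ℕ → Row → List (ℕ × List ℕ)
rowCells ℓ i j [] = []
rowCells ℓ i j (nothing ∷ cs) = rowCells ℓ i (suc j) cs
rowCells ℓ i j (just s ∷ cs) = ((ℓ + j) ∸ i , s) ∷ rowCells ℓ i (suc j) cs

allCells : ℕ → ℕ → Tab → List (ℕ × List ℕ)
allCells ℓ i [] = []
allCells ℓ i (r ∷ rs) = rowCells ℓ i 0 r ++ allCells ℓ (suc i) rs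

anyᵇ : {A : Set} → (A → Bool) → List A → Bool
anyᵇ p [] = false
anyᵇ p (x ∷ xs) = p x ∨ anyᵇ p xs

hfactor : List (ℕ × List ℕ) → ℕ → List ℕ
hfactor cs k = filterᵇ (λ c → anyᵇ (λ p → (c ≡ᵇ proj₁ p) ∧ memb k (proj₂ p)) cs)
                       (downFrom (suc (foldr (λ p a → proj₁ p ⊔ a) 0 cs)))

-- res(S) = h^M ⋯ h^1 for S with entries in [M], contents computed with ℓ = ℓ(κ)
res : ℕ → ℕ → Tab → List (List ℕ)
res M ℓ S = map (λ k → hfactor (allCells ℓ 0 S) (suc k)) (downFrom M)

maxL : List ℕ → ℕ
maxL = foldr _⊔_ 0

replaceFirstGT : ℕ → List ℕ → List ℕ × ℕ
replaceFirstGT x [] = [] , 0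
replaceFirstGT x (y ∷ ys) with x <ᵇ y
... | true = x ∷ ys , y
... | false with replaceFirstGT x ys
...   | ys' , z = y ∷ ys' , z

-- smallest y with [y,x] ⊆ R (given x ∈ R)
walkDown : List ℕ → ℕ → ℕ
walkDown R zero = zero
walkDown R (suc n) = if memb n R then walkDown R n else suc n

headRow : List (List ℕ) → List ℕ
headRow [] = []
headRow (r ∷ _) = r

tailRows : List (List ℕ) → List (List ℕ)
tailRows [] = []
tailRows (_ ∷ rs) = rs

consBoth : List ℕ → List ℕ → List (List ℕ) × List (List ℕ) →
           List (List ℕ) × List (List ℕ)
consBoth a b (p , q) = a ∷ p , b ∷ q

starIns : ℕ → ℕ → List (List ℕ) → List (List ℕ) → List (List ℕ) × List (List ℕ)
starIns q x [] Qs = [ [ x ] ] , [ [ q ] ]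
starIns q x (R ∷ Rs) Qs with null R ∨ (maxL R <ᵇ x)
... | true = (R ++ [ x ]) ∷ Rs , (headRow Qs ++ [ q ]) ∷ tailRows Qs
... | false with memb x R
...   | true = consBoth R (headRow Qs) (starIns q (walkDown R x) Rs (tailRows Qs))
...   | false = consBoth (proj₁ (replaceFirstGT x R)) (headRow Qs)
                         (starIns q (proj₂ (replaceFirstGT x R)) Rs (tailRows Qs))

labelled : ℕ → List (List ℕ) → List (ℕ × ℕ)
labelled k [] = []
labelled k (h ∷ hs) = map (λ x → k , x) h ++ labelled (k ∸ 1) hs

-- ⋆-insertion of a decreasing factorization h^M ⋯ h^1 (given as the list
-- [h^M, …, h^1]); pairs processed from last to first
starInsert : List (List ℕ) → List (List ℕ) × List (List ℕ)
starInsert h = foldr (λ p acc → starIns (proj₁ p) (proj₂ p) (proj₁ acc) (proj₂ acc))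
                     ([] , []) (labelled (length h) h)

tmuRows : ℕ → Partition → Tab
tmuRows i [] = []
tmuRows i (r ∷ rs) = replicate r (just [ suc i ]) ∷ tmuRows (suc i) rs

Tmu : Partition → Tab
Tmu = tmuRows 0

entry : List (List ℕ) → ℕ → ℕ → Maybe ℕ
entry X i j = nthM (nthD [] X i) j

-- ~⋆(h) = (P , Q), with P, Q as partial maps (row, column) ↦ entry.
-- res(T*) = h followed by res(T_μ) (contents taken in λ).
tildeStar : Partition → Partition → List (List ℕ) →
            (ℕ → ℕ → Maybe ℕ) × (ℕ → ℕ → Maybe ℕ)
tildeStar lam mu h = P , Q
  where
  PQ* = starInsert (h ++ res (length mu) (length lam) (Tmu mu))
  P : ℕ → ℕ → Maybe ℕ
  P i j = if j <ᵇ part mu i then nothing else entry (proj₁ PQ*) i j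
  Q : ℕ → ℕ → Maybe ℕ
  Q i j with j <ᵇ part mu i
  ... | true = nothing
  ... | false with entry (proj₂ PQ*) i j
  ...   | nothing = nothing
  ...   | just q = just (q ∸ length mu)

{-# OPTIONS --safe #-}
module Submission where

-- Both sides are computed one row at a time. Read T* in the order of ⋆-insertion.
-- The bottom row of P* depends only on the shape read so far: its entry in column j
-- is the content of the top cell of that column. Hence opening a cell in row i + 1
-- and adding a letter to an occupied cell of row i both make it pass on the content
-- of the first free cell of row i + 1, and the letters passed on are the reading of
-- another set-valued tableau S: the least entries of the rows above the bottom,
-- together with the remaining entries of each row of T* placed one row higher, each
-- in the cell that it would bump. The bottom row of Q* is the row of least entries of
-- the bottom row of T*, and the rest of Q* comes from S. Since a decreasing sequence
-- of letters bumps exactly the non-least entries of the rows of S, uncrowding obeys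
-- the same recursion.

open import Defs
open import Data.Bool using (Bool; true; false; if_then_else_; T; _∨_; _∧_; T?)
open import Data.Bool.Properties using (T-∨; T-∧; T-≡)
open import Data.Empty using (⊥; ⊥-elim)
open import Data.List using (List; []; _∷_; _++_; length; [_]; map; foldr; null; reverse; replicate; head; downFrom; filter)
open import Data.List.Membership.Propositional using (_∈_)
open import Data.List.Membership.Propositional.Properties using (∈-++⁺ʳ; ∈-++⁺ˡ; ∈-++⁻; ∈-map⁺; ∈-map⁻; ∈-filter⁺; ∈-filter⁻; ∈-downFrom⁺)
open import Data.List.Properties using (++-assoc; ++-identityʳ; length-++; length-map; length-downFrom; length-reverse; map-++; map-∘; map-cong; map-id; reverse-++; reverse-involutive; reverse-map; unfold-reverse)
open import Data.List.Relation.Unary.All as All using (All; []; _∷_)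
import Data.List.Relation.Unary.All.Properties as Allₚ
open import Data.List.Relation.Unary.AllPairs as AllPairs using (AllPairs; []; _∷_)
import Data.List.Relation.Unary.AllPairs.Properties as AllPairsₚ
open import Data.List.Relation.Unary.Any using (here; there)
import Data.List.Relation.Unary.Any.Properties as Anyₚ
open import Data.Maybe as Maybe using (Maybe; just; nothing)
open import Data.Maybe.Properties using (just-injective)
open import Data.Nat
open import Data.Nat.Properties
open import Data.Product using (_×_; _,_; ∃; proj₁; proj₂; map₂)
open import Data.Sum using (_⊎_; inj₁; inj₂)
open import Data.Unit using (⊤; tt)
open import Function using (_∘_; id)
open import Function.Bundles using (Equivalence)
open import Relation.Binary.Definitions using (tri<; tri≈; tri>)
open import Relation.Binary.PropositionalEquality using (_≡_; _≢_; refl; sym; trans; cong; cong₂; subst; subst₂; module ≡-Reasoning)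
open import Relation.Nullary using (¬_; yes; no)

-- The recursion runs on lists of events, not on tableaux: S would have to be reassembled as a
-- tableau at every level, while `Ordered` and `Valid` already say what the argument uses about a
-- reading, and both pass from `L` to `next L`. The same `ℓ` serves at every level. The letter
-- passed on is one more than the content of the first free cell of row `i + 1` in `T*`, and
-- renumbering the rows from 0 raises the content of that cell by exactly one. Uncrowding finishes
-- all higher rows before it touches a row, whereas the recursion moves every row up at once. The
-- two agree because each row receives the same letters in the same order. Skew shapes are absorbed
-- by `T*`, whose shape is straight: the entries filled in for `mu` are at most `n`, the length of
-- `mu`, so truncated subtraction of `n` turns all of them into 0.

≡ᵇ-true : ∀ i j → (i ≡ᵇ j) ≡ true → i ≡ j
≡ᵇ-true i j eq = ≡ᵇ⇒≡ i j (subst T (sym eq) tt)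

≡ᵇ-refl : ∀ i → (i ≡ᵇ i) ≡ true
≡ᵇ-refl zero = refl
≡ᵇ-refl (suc i) = ≡ᵇ-refl i

≡ᵇ-false : ∀ i j → ¬ i ≡ j → (i ≡ᵇ j) ≡ false
≡ᵇ-false i j i≢j with i ≡ᵇ j in eq
... | true = ⊥-elim (i≢j (≡ᵇ-true i j eq))
... | false = refl

<ᵇ-true : ∀ {i j} → i < j → (i <ᵇ j) ≡ true
<ᵇ-true {i} {j} lt with i <ᵇ j | <⇒<ᵇ lt
... | true | _ = refl

<ᵇ-false : ∀ {i j} → j ≤ i → (i <ᵇ j) ≡ false
<ᵇ-false {i} {j} le with i <ᵇ j in eq
... | true = ⊥-elim (<⇒≱ (<ᵇ⇒< i j (subst T (sym eq) tt)) le)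
... | false = refl

-- Row bumping of letters into lists

bump₁ : ℕ → List ℕ → List ℕ
bump₁ x [] = [ x ]
bump₁ x (y ∷ ys) = if x <ᵇ y then x ∷ ys else y ∷ bump₁ x ys

-- The output is a list of at most one letter, so that the letters bumped out in succession
-- concatenate.
bump₂ : ℕ → List ℕ → List ℕ
bump₂ x [] = []
bump₂ x (y ∷ ys) = if x <ᵇ y then [ y ] else bump₂ x ys

bumps₁ : List ℕ → List ℕ → List ℕ
bumps₁ M [] = M
bumps₁ M (x ∷ D) = bumps₁ (bump₁ x M) D

bumps₂ : List ℕ → List ℕ → List ℕ
bumps₂ M [] = []
bumps₂ M (x ∷ D) = bump₂ x M ++ bumps₂ (bump₁ x M) D

bumps₁-++ : ∀ M D D′ → bumps₁ M (D ++ D′) ≡ bumps₁ (bumps₁ M D) D′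
bumps₁-++ M [] D′ = refl
bumps₁-++ M (x ∷ D) D′ = bumps₁-++ (bump₁ x M) D D′

bumps₂-++ : ∀ M D D′ → bumps₂ M (D ++ D′) ≡ bumps₂ M D ++ bumps₂ (bumps₁ M D) D′
bumps₂-++ M [] D′ = refl
bumps₂-++ M (x ∷ D) D′ = trans (cong (bump₂ x M ++_) (bumps₂-++ (bump₁ x M) D D′))
                                (sym (++-assoc (bump₂ x M) _ _))

bump₁-≥ : ∀ {x} {M} N → All (_≤ x) M → bump₁ x (M ++ N) ≡ M ++ bump₁ x N
bump₁-≥ N [] = refl
bump₁-≥ N (y≤x ∷ M≤x) rewrite <ᵇ-false y≤x = cong (_ ∷_) (bump₁-≥ N M≤x)

bump₂-≥ : ∀ {x} {M} N → All (_≤ x) M → bump₂ x (M ++ N) ≡ bump₂ x N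
bump₂-≥ N [] = refl
bump₂-≥ N (y≤x ∷ M≤x) rewrite <ᵇ-false y≤x = bump₂-≥ N M≤x

bump₁-append : ∀ {x M} → All (_≤ x) M → bump₁ x M ≡ M ++ [ x ]
bump₁-append {x} {M} M≤x = trans (cong (bump₁ x) (sym (++-identityʳ M))) (bump₁-≥ [] M≤x)

bump₂-append : ∀ {x M} → All (_≤ x) M → bump₂ x M ≡ []
bump₂-append {x} {M} M≤x = trans (cong (bump₂ x) (sym (++-identityʳ M))) (bump₂-≥ [] M≤x)

bump₁-∈ : ∀ x M → x ∈ bump₁ x M
bump₁-∈ x [] = here refl
bump₁-∈ x (y ∷ M) with x <ᵇ y
... | true = here refl
... | false = there (bump₁-∈ x M)

bump₁-++ : ∀ {x y} {M} N → y ∈ M → x < y → bump₁ x (M ++ N) ≡ bump₁ x M ++ N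
bump₁-++ N (here refl) x<y rewrite <ᵇ-true x<y = refl
bump₁-++ {x} {M = z ∷ _} N (there y∈M) x<y with x <ᵇ z
... | true = refl
... | false = cong (z ∷_) (bump₁-++ N y∈M x<y)

bump₂-++ : ∀ {x y} {M} N → y ∈ M → x < y → bump₂ x (M ++ N) ≡ bump₂ x M
bump₂-++ N (here refl) x<y rewrite <ᵇ-true x<y = refl
bump₂-++ {x} {M = z ∷ _} N (there y∈M) x<y with x <ᵇ z
... | true = refl
... | false = bump₂-++ N y∈M x<y

-- The first letter finds something to bump inside `M`, since `y` is there. It then lies in the row
-- itself and, `D` being decreasing, takes the part of `y` for the next letter; thus `N` is never
-- reached.
bumps-++ : ∀ {y M D} N → y ∈ M → All (_< y) D → AllPairs _>_ D →
           bumps₁ (M ++ N) D ≡ bumps₁ M D ++ N × bumps₂ (M ++ N) D ≡ bumps₂ M D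
bumps-++ N y∈M [] [] = refl , refl
bumps-++ {M = M} {D = x ∷ D} N y∈M (x<y ∷ _) (D<x ∷ ps)
  rewrite bump₁-++ N y∈M x<y | bump₂-++ N y∈M x<y
  with bumps-++ {M = bump₁ x M} N (bump₁-∈ x M) D<x ps
... | eq₁ , eq₂ = eq₁ , cong (bump₂ x M ++_) eq₂

-- Insertion events

-- The letters of a set-valued tableau in the order in which ⋆-insertion reads
-- them, most recent first: `new k i j` opens cell (i , j) with its least entry k,
-- and `mul k i j` adds k to the already occupied cell (i , j).
data Event : Set where
  new mul : (k i j : ℕ) → Event

lab row col : Event → ℕ
lab (new k i j) = k
lab (mul k i j) = k
row (new k i j) = i
row (mul k i j) = i
col (new k i j) = j
col (mul k i j) = j

IsNew : Event → Set
IsNew (new k i j) = ⊤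
IsNew (mul k i j) = ⊥

news : ℕ → List Event → List ℕ
news i [] = []
news i (new k i′ j ∷ L) = if i ≡ᵇ i′ then news i L ++ [ k ] else news i L
news i (mul k i′ j ∷ L) = news i L

muls : ℕ → List Event → List ℕ
muls i [] = []
muls i (new k i′ j ∷ L) = muls i L
muls i (mul k i′ j ∷ L) = if i ≡ᵇ i′ then k ∷ muls i L else muls i L

ν : List Event → ℕ → ℕ
ν L i = length (news i L)

-- Whether the most recent event that makes the bottom row emit an event into row
-- i (a new cell in row suc i, or an addition to a cell of row i) is an addition;
-- equivalently, row i of the emitted tableau is one cell longer than row suc i.
flag : ℕ → List Event → Bool
flag i [] = false
flag i (new k zero j ∷ L) = flag i L
flag i (new k (suc i′) j ∷ L) = if i ≡ᵇ i′ then false else flag i L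
flag i (mul k i′ j ∷ L) = if i ≡ᵇ i′ then true else flag i L

emit : Bool → ℕ → ℕ → ℕ → Event
emit false = new
emit true = mul

-- The events passed on by the bottom row of P*, with rows renumbered from 0.
next : List Event → List Event
next [] = []
next (new k zero j ∷ L) = next L
next (new k (suc i) j ∷ L) = emit (flag i L) k i (ν L (suc i)) ∷ next L
next (mul k i j ∷ L) = emit (flag i L) k i (ν L (suc i)) ∷ next L

-- Equal labels form a horizontal strip read towards the south-east, in which only
-- the leftmost entry of a row can be an addition.
data _≻_ (e′ e : Event) : Set where
  lab< : lab e < lab e′ → e′ ≻ e
  row< : lab e ≡ lab e′ → row e′ < row e → e′ ≻ e
  row≡ : lab e ≡ lab e′ → row e′ ≡ row e → IsNew e′ → e′ ≻ e

Ordered : List Event → Set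
Ordered = AllPairs _≻_

data Target : Event → ℕ → Set where
  new : ∀ {k r j} → Target (new k (suc r) j) r
  mul : ∀ {k r j} → Target (mul k r j) r

≻-lab : ∀ {e′ e} → e′ ≻ e → lab e ≤ lab e′
≻-lab (lab< lt) = <⇒≤ lt
≻-lab (row< eq _) = ≤-reflexive eq
≻-lab (row≡ eq _ _) = ≤-reflexive eq

-- An opening emits one row lower and an addition emits into its own row. The delicate pair is an
-- addition `e′` following an opening in the same row with the same label, whose target would be the
-- higher one; `row≡` excludes it.
≻-target : ∀ {e′ e r s} → Target e′ r → Target e s → e′ ≻ e →
           lab e < lab e′ ⊎ (lab e ≡ lab e′ × r ≤ s)
≻-target _ _ (lab< lt) = inj₁ lt
≻-target new new (row< eq lt) = inj₂ (eq , <⇒≤ (s≤s⁻¹ lt))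
≻-target new new (row≡ eq refl _) = inj₂ (eq , ≤-refl)
≻-target new mul (row< eq lt) = inj₂ (eq , ≤-trans (n≤1+n _) (<⇒≤ lt))
≻-target new mul (row≡ eq refl _) = inj₂ (eq , n≤1+n _)
≻-target mul new (row< eq lt) = inj₂ (eq , s≤s⁻¹ lt)
≻-target mul mul (row< eq lt) = inj₂ (eq , <⇒≤ lt)

-- With equal labels the later event lies weakly lower, which excludes an opening in row `suc r`;
-- and it cannot be an addition in row `r`, where `row≡` admits only openings.
≻-mul : ∀ {e′ k r j} → Target e′ r → e′ ≻ mul k r j → k < lab e′
≻-mul _ (lab< lt) = lt
≻-mul new (row< eq lt) = ⊥-elim (<⇒≱ lt (n≤1+n _))
≻-mul new (row≡ eq () _)
≻-mul mul (row< eq lt) = ⊥-elim (<-irrefl refl lt)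
≻-mul mul (row≡ eq _ ())

lab-emit : ∀ b {k i j} → lab (emit b k i j) ≡ k
lab-emit false = refl
lab-emit true = refl

row-emit : ∀ b {k i j} → row (emit b k i j) ≡ i
row-emit false = refl
row-emit true = refl

emit-row-≢ : ∀ b {k i c r} → (r ≡ᵇ i) ≡ false → row (emit b k i c) ≢ r
emit-row-≢ b {r = r} eq refl with trans (sym eq) (subst (λ z → (r ≡ᵇ z) ≡ true) (row-emit b) (≡ᵇ-refl r))
... | ()

next-All : ∀ {Q P : Event → Set} →
           (∀ {e s} b c → Target e s → Q e → P (emit b (lab e) s c)) →
           ∀ {L} → All Q L → All P (next L)
next-All h [] = []
next-All h {new k zero j ∷ L} (q ∷ qs) = next-All h qs
next-All h {new k (suc i) j ∷ L} (q ∷ qs) = h (flag i L) _ new q ∷ next-All h qs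
next-All h {mul k i j ∷ L} (q ∷ qs) = h (flag i L) _ mul q ∷ next-All h qs

-- This makes an emitted addition the leftmost entry of its label in its row. The last event that
-- emitted into row `r` was an addition, whose label is strictly smaller by `≻-mul`, and everything
-- before it has a label at most that one.
flag-lab : ∀ {e′ r} L → Target e′ r → flag r L ≡ true → All (e′ ≻_) L → Ordered L →
           All (λ E → row E ≡ r → lab E < lab e′) (next L)
flag-lab [] t fl [] [] = []
flag-lab (new k zero j ∷ L) t fl (p ∷ ps) (q ∷ qs) = flag-lab L t fl ps qs
flag-lab {r = r} (new k (suc i) j ∷ L) t fl (p ∷ ps) (q ∷ qs) with r ≡ᵇ i in eq
... | false = (⊥-elim ∘ emit-row-≢ (flag i L) eq) ∷ flag-lab L t fl ps qs
flag-lab {e′} {r} (mul k i j ∷ L) t fl (p ∷ ps) (q ∷ qs) with r ≡ᵇ i in eq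
... | false = (⊥-elim ∘ emit-row-≢ (flag i L) eq) ∷ flag-lab L t fl ps qs
... | true with ≡ᵇ-true r i eq
...   | refl = (λ _ → subst (_< lab e′) (sym (lab-emit (flag r L))) k<k′) ∷
               next-All (λ b c t′ p′ _ → subst (_< lab e′) (sym (lab-emit b)) (≤-<-trans (≻-lab p′) k<k′)) q
  where
  k<k′ : k < lab e′
  k<k′ = ≻-mul t p

emit-≻ : ∀ {e′ r c} L → Target e′ r → All (e′ ≻_) L → Ordered L →
         All (emit (flag r L) (lab e′) r c ≻_) (next L)
emit-≻ {e′} {r} {c} L t ps qs = go (flag r L) refl
  where
  LabOrRow : Event → Set
  LabOrRow E = lab E < lab e′ ⊎ (lab E ≡ lab e′ × r ≤ row E)
  labOrRow : ∀ {e s} b c′ → Target e s → e′ ≻ e → LabOrRow (emit b (lab e) s c′)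
  labOrRow {e} {s} b c′ t′ p rewrite lab-emit b {lab e} {s} {c′} | row-emit b {lab e} {s} {c′} = ≻-target t t′ p
  new-≻ : ∀ {E} → LabOrRow E → new (lab e′) r c ≻ E
  new-≻ (inj₁ lt) = lab< lt
  new-≻ (inj₂ (leq , r≤s)) with m≤n⇒m<n∨m≡n r≤s
  ... | inj₁ lt = row< leq lt
  ... | inj₂ req = row≡ leq req tt
  mul-≻ : ∀ {E} → LabOrRow E × (row E ≡ r → lab E < lab e′) → mul (lab e′) r c ≻ E
  mul-≻ (inj₁ lt , _) = lab< lt
  mul-≻ (inj₂ (leq , r≤s) , g) with m≤n⇒m<n∨m≡n r≤s
  ... | inj₁ lt = row< leq lt
  ... | inj₂ req = lab< (g (sym req))
  go : ∀ b → flag r L ≡ b → All (emit b (lab e′) r c ≻_) (next L)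
  go false _ = All.map new-≻ (next-All labOrRow ps)
  go true eq = All.zipWith mul-≻ (next-All labOrRow ps , flag-lab L t eq ps qs)

next-Ordered : ∀ {L} → Ordered L → Ordered (next L)
next-Ordered [] = []
next-Ordered {new k zero j ∷ L} (p ∷ ps) = next-Ordered ps
next-Ordered {new k (suc i) j ∷ L} (p ∷ ps) = emit-≻ L new p ps ∷ next-Ordered ps
next-Ordered {mul k i j ∷ L} (p ∷ ps) = emit-≻ L mul p ps ∷ next-Ordered ps

-- Least and remaining entries of each row under `next`

news-All : ∀ {P : Event → Set} {Q : ℕ → Set} i → (∀ {k j} → P (new k i j) → Q k) →
           ∀ {L} → All P L → All Q (news i L)
news-All i h [] = []
news-All i h {new k i′ j ∷ L} (p ∷ ps) with i ≡ᵇ i′ in eq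
... | false = news-All i h ps
... | true with ≡ᵇ-true i i′ eq
...   | refl = Allₚ.++⁺ (news-All i h ps) (h p ∷ [])
news-All i h {mul k i′ j ∷ L} (p ∷ ps) = news-All i h ps

muls-All : ∀ {P : Event → Set} {Q : ℕ → Set} i → (∀ {k j} → P (mul k i j) → Q k) →
           ∀ {L} → All P L → All Q (muls i L)
muls-All i h [] = []
muls-All i h {new k i′ j ∷ L} (p ∷ ps) = muls-All i h ps
muls-All i h {mul k i′ j ∷ L} (p ∷ ps) with i ≡ᵇ i′ in eq
... | false = muls-All i h ps
... | true with ≡ᵇ-true i i′ eq
...   | refl = h p ∷ muls-All i h ps

muls-AllPairs : ∀ i {L} → Ordered L → AllPairs _>_ (muls i L)
muls-AllPairs i [] = []
muls-AllPairs i {new k i′ j ∷ L} (p ∷ ps) = muls-AllPairs i ps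
muls-AllPairs i {mul k i′ j ∷ L} (p ∷ ps) with i ≡ᵇ i′ in eq
... | false = muls-AllPairs i ps
... | true with ≡ᵇ-true i i′ eq
...   | refl = muls-All i (≻-mul mul) p ∷ muls-AllPairs i ps

flag-true : ∀ i L → Ordered L → flag i L ≡ true →
            ∃ λ x → ∃ λ D → muls i L ≡ x ∷ D × All (_≤ x) (news (suc i) L)
flag-true i (new k zero j ∷ L) (p ∷ ps) fl = flag-true i L ps fl
flag-true i (new k (suc i′) j ∷ L) (p ∷ ps) fl with i ≡ᵇ i′
... | false = flag-true i L ps fl
flag-true i (mul k i′ j ∷ L) (p ∷ ps) fl with i ≡ᵇ i′
... | false = flag-true i L ps fl
... | true = k , muls i L , refl , news-All (suc i) ≻-lab p

-- The witness `y` is the label of the most recent opening in row `suc i`: no addition to row `i`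
-- has happened since, and the earlier ones are smaller by `≻-mul`.
flag-false : ∀ i L → Ordered L → flag i L ≡ false →
             muls i L ≡ [] ⊎ ∃ λ y → y ∈ news (suc i) L × All (_< y) (muls i L)
flag-false i [] [] fl = inj₁ refl
flag-false i (new k zero j ∷ L) (p ∷ ps) fl = flag-false i L ps fl
flag-false i (new k (suc i′) j ∷ L) (p ∷ ps) fl with i ≡ᵇ i′ in eq
... | false = flag-false i L ps fl
... | true with ≡ᵇ-true i i′ eq
...   | refl = inj₂ (k , ∈-++⁺ʳ (news (suc i) L) (here refl) , muls-All i (≻-mul new) p)
flag-false i (mul k i′ j ∷ L) (p ∷ ps) fl with i ≡ᵇ i′
... | false = flag-false i L ps fl

bumps-snoc-false : ∀ i L → Ordered L → flag i L ≡ false → ∀ k →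
  bumps₁ (news (suc i) L ++ [ k ]) (muls i L) ≡ bumps₁ (news (suc i) L) (muls i L) ++ [ k ] ×
  bumps₂ (news (suc i) L ++ [ k ]) (muls i L) ≡ bumps₂ (news (suc i) L) (muls i L)
bumps-snoc-false i L o fl k with flag-false i L o fl
... | inj₁ eq rewrite eq = refl , refl
... | inj₂ (y , y∈ , lt) = bumps-++ [ k ] y∈ lt (muls-AllPairs i o)

-- Without `k`, the largest remaining entry `x` is appended to the row; with `k` at the end, `x`
-- bumps `k` and takes the same place. So the row comes out the same and `k` is the first letter
-- out.
bumps-snoc-true : ∀ i L → Ordered L → flag i L ≡ true → ∀ {k} → All (_< k) (muls i L) →
  bumps₁ (news (suc i) L ++ [ k ]) (muls i L) ≡ bumps₁ (news (suc i) L) (muls i L) ×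
  bumps₂ (news (suc i) L ++ [ k ]) (muls i L) ≡ k ∷ bumps₂ (news (suc i) L) (muls i L)
bumps-snoc-true i L o fl {k} lt with muls i L | flag-true i L o fl
... | _ | x , D , refl , M≤x with lt
... | x<k ∷ _
  rewrite bump₁-≥ [ k ] M≤x | bump₂-≥ [ k ] M≤x | <ᵇ-true x<k
        | bump₁-append M≤x | bump₂-append M≤x = refl , refl

-- Only the row `i` into which the latest event emits changes. An opening in row `suc i` appends `k`
-- to the least entries; an addition of `k` to row `i` makes `k` the first letter to be bumped in,
-- and as it is at least every least entry of row `suc i` it is appended there too. Both cases thus
-- come down to `bumps-emit`.
bumps-next : ∀ L → Ordered L → ∀ i →
             bumps₁ (news (suc i) L) (muls i L) ≡ news i (next L) ×
             bumps₂ (news (suc i) L) (muls i L) ≡ muls i (next L)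

bumps-emit : ∀ L → Ordered L → ∀ i k → All (_< k) (muls i L) → ∀ c →
             let L′ = emit (flag i L) k i c ∷ next L in
             bumps₁ (news (suc i) L ++ [ k ]) (muls i L) ≡ news i L′ ×
             bumps₂ (news (suc i) L ++ [ k ]) (muls i L) ≡ muls i L′
bumps-emit L o i k lt c with flag i L in fl
... | false rewrite ≡ᵇ-refl i =
  let eq₁ , eq₂ = bumps-next L o i ; e₁ , e₂ = bumps-snoc-false i L o fl k
  in trans e₁ (cong (_++ [ k ]) eq₁) , trans e₂ eq₂
... | true rewrite ≡ᵇ-refl i =
  let eq₁ , eq₂ = bumps-next L o i ; e₁ , e₂ = bumps-snoc-true i L o fl lt
  in trans e₁ eq₁ , trans e₂ (cong (k ∷_) eq₂)

news-emit-≢ : ∀ b {k i i′ c L} → (i ≡ᵇ i′) ≡ false → news i (emit b k i′ c ∷ L) ≡ news i L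
news-emit-≢ false eq rewrite eq = refl
news-emit-≢ true eq = refl

muls-emit-≢ : ∀ b {k i i′ c L} → (i ≡ᵇ i′) ≡ false → muls i (emit b k i′ c ∷ L) ≡ muls i L
muls-emit-≢ false eq = refl
muls-emit-≢ true eq rewrite eq = refl

bumps-next [] [] i = refl , refl
bumps-next (new k zero j ∷ L) (p ∷ ps) i = bumps-next L ps i
bumps-next (new k (suc i′) j ∷ L) (p ∷ ps) i with i ≡ᵇ i′ in eq
... | false rewrite news-emit-≢ (flag i′ L) {k} {i} {i′} {ν L (suc i′)} {next L} eq
                  | muls-emit-≢ (flag i′ L) {k} {i} {i′} {ν L (suc i′)} {next L} eq = bumps-next L ps i
... | true with ≡ᵇ-true i i′ eq
...   | refl = bumps-emit L ps i k (muls-All i (≻-mul new) p) _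
bumps-next (mul k i′ j ∷ L) (p ∷ ps) i with i ≡ᵇ i′ in eq
... | false rewrite news-emit-≢ (flag i′ L) {k} {i} {i′} {ν L (suc i′)} {next L} eq
                  | muls-emit-≢ (flag i′ L) {k} {i} {i′} {ν L (suc i′)} {next L} eq = bumps-next L ps i
... | true with ≡ᵇ-true i i′ eq
...   | refl
  rewrite bump₁-append (news-All {Q = _≤ k} (suc i) ≻-lab p)
        | bump₂-append (news-All {Q = _≤ k} (suc i) ≻-lab p) = bumps-emit L ps i k (muls-All i (≻-mul mul) p) _

-- The bottom row of ⋆-insertion

nthM-< : ∀ {A : Set} (R : List A) j {v} → nthM R j ≡ just v → j < length R
nthM-< (_ ∷ R) zero eq = s≤s z≤n
nthM-< (_ ∷ R) (suc j) eq = s≤s (nthM-< R j eq)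

nthM-split : ∀ {A : Set} (R : List A) j {v} → nthM R j ≡ just v →
             ∃ λ S → ∃ λ U → R ≡ S ++ v ∷ U × length S ≡ j
nthM-split (x ∷ R) zero refl = [] , R , refl , refl
nthM-split (x ∷ R) (suc j) eq with nthM-split R j eq
... | S , U , refl , refl = x ∷ S , U , refl , refl

nthM-++ˡ : ∀ {A : Set} (S U : List A) {j} → j < length S → nthM (S ++ U) j ≡ nthM S j
nthM-++ˡ (x ∷ S) U {zero} lt = refl
nthM-++ˡ (x ∷ S) U {suc j} lt = nthM-++ˡ S U (s≤s⁻¹ lt)

nthM-++ʳ : ∀ {A : Set} (S U : List A) j → nthM (S ++ U) (length S + j) ≡ nthM U j
nthM-++ʳ [] U j = refl
nthM-++ʳ (x ∷ S) U j = nthM-++ʳ S U j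

nthM-middle : ∀ {A : Set} (S : List A) x U → nthM (S ++ x ∷ U) (length S) ≡ just x
nthM-middle [] x U = refl
nthM-middle (_ ∷ S) x U = nthM-middle S x U

nthM-replace : ∀ {A : Set} (S : List A) x y U {j} → j ≢ length S →
               nthM (S ++ x ∷ U) j ≡ nthM (S ++ y ∷ U) j
nthM-replace [] x y U {zero} j≢ = ⊥-elim (j≢ refl)
nthM-replace [] x y U {suc j} j≢ = refl
nthM-replace (z ∷ S) x y U {zero} j≢ = refl
nthM-replace (z ∷ S) x y U {suc j} j≢ = nthM-replace S x y U (j≢ ∘ cong suc)

nthM-All : ∀ {A : Set} {P : A → Set} R → (∀ j v → nthM R j ≡ just v → P v) → All P R
nthM-All [] h = []
nthM-All (x ∷ R) h = h 0 x refl ∷ nthM-All R (λ j → h (suc j))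

nthM-∈ : ∀ {A : Set} (R : List A) j {v} → nthM R j ≡ just v → v ∈ R
nthM-∈ (x ∷ R) zero refl = here refl
nthM-∈ (x ∷ R) (suc j) eq = there (nthM-∈ R j eq)

memb-∈ : ∀ {x R} → x ∈ R → memb x R ≡ true
memb-∈ {x} (here refl) rewrite ≡ᵇ-refl x = refl
memb-∈ {x} {y ∷ R} (there x∈R) with x ≡ᵇ y
... | true = refl
... | false = memb-∈ x∈R

memb-∉ : ∀ {x R} → All (x ≢_) R → memb x R ≡ false
memb-∉ [] = refl
memb-∉ {x} {y ∷ R} (x≢y ∷ ps) rewrite ≡ᵇ-false x y x≢y = memb-∉ ps

maxL-≥ : ∀ {y R} → y ∈ R → y ≤ maxL R
maxL-≥ {R = y ∷ R} (here refl) = m≤m⊔n y (maxL R)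
maxL-≥ {R = z ∷ R} (there y∈R) = ≤-trans (maxL-≥ y∈R) (m≤n⊔m z (maxL R))

maxL-< : ∀ {x y R} → All (_< x) (y ∷ R) → maxL (y ∷ R) < x
maxL-< {x} {y} (y<x ∷ []) = subst (_< x) (sym (⊔-identityʳ y)) y<x
maxL-< (y<x ∷ p ∷ ps) = ⊔-lub y<x (maxL-< (p ∷ ps))

fits : ℕ → List ℕ → Bool
fits x R = null R ∨ (maxL R <ᵇ x)

fits-true : ∀ {x R} → All (_< x) R → fits x R ≡ true
fits-true [] = refl
fits-true (p ∷ ps) = <ᵇ-true (maxL-< (p ∷ ps))

fits-false : ∀ {x y R} → y ∈ R → x ≤ y → fits x R ≡ false
fits-false {R = _ ∷ _} y∈R x≤y = <ᵇ-false (≤-trans x≤y (maxL-≥ y∈R))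

-- The lower end of the run is written `suc y` because the walk tests predecessors and stops at zero
-- without a test.
walkDown-≡ : ∀ R y d → (∀ c → c < d → (c + suc y) ∈ R) → All (y ≢_) R →
             walkDown R (d + suc y) ≡ suc y
walkDown-≡ R y zero h y∉R rewrite memb-∉ y∉R = refl
walkDown-≡ R y (suc d) h y∉R rewrite memb-∈ (h d ≤-refl) =
  walkDown-≡ R y d (λ c c<d → h c (m≤n⇒m≤1+n c<d)) y∉R

replaceFirstGT-≡ : ∀ {x v S} U → All (_< x) S → x < v →
                   replaceFirstGT x (S ++ v ∷ U) ≡ (S ++ x ∷ U , v)
replaceFirstGT-≡ U [] x<v rewrite <ᵇ-true x<v = refl
replaceFirstGT-≡ U (p ∷ ps) x<v rewrite <ᵇ-false (<⇒≤ p) | replaceFirstGT-≡ U ps x<v = refl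

starIns-append : ∀ q {x R} Rs Q Qs → All (_< x) R →
                 starIns q x (R ∷ Rs) (Q ∷ Qs) ≡ ((R ++ [ x ]) ∷ Rs , (Q ++ [ q ]) ∷ Qs)
starIns-append q {x} {R} Rs Q Qs R<x with null R ∨ (maxL R <ᵇ x) | fits-true R<x
... | true | _ = refl

starIns-walk : ∀ q {x y R} Rs Q Qs → x ∈ R → walkDown R x ≡ y →
               starIns q x (R ∷ Rs) (Q ∷ Qs) ≡ consBoth R Q (starIns q y Rs Qs)
starIns-walk q {x} {y} {R} Rs Q Qs x∈R refl with null R ∨ (maxL R <ᵇ x) | fits-false x∈R ≤-refl
... | false | _ with memb x R | memb-∈ x∈R
...   | true | _ = refl

starIns-bump : ∀ q {x v S} U Rs Q Qs → All (_< x) S → x < v → All (x <_) U →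
               starIns q x ((S ++ v ∷ U) ∷ Rs) (Q ∷ Qs) ≡
               consBoth (S ++ x ∷ U) Q (starIns q v Rs Qs)
starIns-bump q {x} {v} {S} U Rs Q Qs S<x x<v x<U
  with null (S ++ v ∷ U) ∨ (maxL (S ++ v ∷ U) <ᵇ x) | fits-false {R = S ++ v ∷ U} (∈-++⁺ʳ S (here refl)) (<⇒≤ x<v)
... | false | _ with memb x (S ++ v ∷ U)
                   | memb-∉ (Allₚ.++⁺ (All.map (λ p → <⇒≢ p ∘ sym) S<x) (<⇒≢ x<v ∷ All.map <⇒≢ x<U))
...   | false | _ rewrite replaceFirstGT-≡ U S<x x<v = refl

Mono : (ℕ → ℕ) → Set
Mono n = ∀ i → n (suc i) ≤ n i

antitone : ∀ {n} → Mono n → ∀ {i i′} → i ≤ i′ → n i′ ≤ n i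
antitone mono {i′ = zero} z≤n = ≤-refl
antitone mono {i} {suc i′} i≤i′ with m≤n⇒m<n∨m≡n i≤i′
... | inj₁ lt = ≤-trans (mono i′) (antitone mono (s≤s⁻¹ lt))
... | inj₂ refl = ≤-refl

-- The `i` found is the row of the top cell of column `j`.
block : ∀ (n : ℕ → ℕ) N {j} → n N ≤ j → j < n 0 → ∃ λ i → n (suc i) ≤ j × j < n i
block n zero le lt = ⊥-elim (<⇒≱ lt le)
block n (suc N) {j} le lt with j <? n N
... | yes j<nN = N , le , j<nN
... | no j≮nN = block n N (≮⇒≥ j≮nN) lt

module _ (ℓ : ℕ) where

  -- The bottom row of P* for the shape with row lengths n: column j, of height
  -- suc i, has bottom entry ℓ + j − i, the content of its top cell.
  record BottomRow (n : ℕ → ℕ) (R : List ℕ) : Set where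
    field
      len : length R ≡ n 0
      val : ∀ i j → n (suc i) ≤ j → j < n i → ∃ λ v → nthM R j ≡ just v × v + i ≡ ℓ + j

  module _ {n R} (mono : Mono n) (n≡0 : n ℓ ≡ 0) (b : BottomRow n R) where
    open BottomRow b

    nthM-block : ∀ j {v} → nthM R j ≡ just v → ∃ λ i → n (suc i) ≤ j × j < n i × v + i ≡ ℓ + j
    nthM-block j eq with block n ℓ (≤-trans (≤-reflexive n≡0) z≤n) (subst (j <_) len (nthM-< R j eq))
    ... | i , le , lt with val i j le lt
    ...   | v , eq′ , sum with trans (sym eq) eq′
    ...     | refl = i , le , lt , sum

    -- A column that reaches row `suc i` has its top cell there or higher, and contents fall going
    -- up.
    left-bound : ∀ i j {v} → j < n (suc i) → nthM R j ≡ just v → v + suc i ≤ ℓ + j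
    left-bound i j {v} j< eq with nthM-block j eq
    ... | i′ , le , lt , sum with suc i ≤? i′
    ...   | yes i<i′ = ≤-trans (+-monoʳ-≤ v i<i′) (≤-reflexive sum)
    ...   | no i≮i′ = ⊥-elim (<⇒≱ j< (≤-trans (antitone mono (≰⇒> i≮i′)) le))

    right-bound : ∀ i j {v} → n (suc i) ≤ j → nthM R j ≡ just v → ℓ + j ≤ v + i
    right-bound i j {v} ≤j eq with nthM-block j eq
    ... | i′ , le , lt , sum with i′ ≤? i
    ...   | yes i′≤i = ≤-trans (≤-reflexive (sym sum)) (+-monoʳ-≤ v i′≤i)
    ...   | no i′≰i = ⊥-elim (<⇒≱ lt (≤-trans (antitone mono (≰⇒> i′≰i)) ≤j))

  content : Event → ℕ
  content e = (ℓ + col e) ∸ row e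

  -- An opening must be at an addable corner. An addition must be at the top of its column, so that
  -- its content is an entry of the bottom row. The bound `ℓ` on rows makes the truncated
  -- subtraction in `content` exact.
  Ok : (ℕ → ℕ) → Event → Set
  Ok n (new k zero j) = j ≡ n 0 × 0 < ℓ
  Ok n (new k (suc i) j) = j ≡ n (suc i) × suc i < ℓ × n (suc i) < n i
  Ok n (mul k i j) = n (suc i) ≤ j × j < n i × i < ℓ

  data Valid : List Event → Set where
    [] : Valid []
    _∷_ : ∀ {e L} → Ok (ν L) e → Valid L → Valid (e ∷ L)

-- The shape of the emitted tableau

ν-same : ∀ k i j L → ν (new k i j ∷ L) i ≡ suc (ν L i)
ν-same k i j L rewrite ≡ᵇ-refl i = trans (length-++ (news i L)) (+-comm _ 1)

ν-diff : ∀ k {i} i′ j L → i ≢ i′ → ν (new k i′ j ∷ L) i ≡ ν L i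
ν-diff k {i} i′ j L i≢i′ rewrite ≡ᵇ-false i i′ i≢i′ = refl

bit : Bool → ℕ
bit false = 0
bit true = 1

-- Keeping `bit b` on the left treats both kinds of event alike; `ν-next` cancels it.
ν-emit : ∀ b k i c L → ν (emit b k i c ∷ L) i + bit b ≡ suc (ν L i)
ν-emit false k i c L = trans (+-identityʳ _) (ν-same k i c L)
ν-emit true k i c L = +-comm _ 1

ν-next : ∀ L i → ν (next L) i ≡ ν L (suc i) + bit (flag i L)
ν-next [] i = refl
ν-next (new k zero j ∷ L) i = ν-next L i
ν-next (new k (suc i′) j ∷ L) i with i ≡ᵇ i′ in eq
... | false = trans (cong length (news-emit-≢ (flag i′ L) {k} {i} {i′} {ν L (suc i′)} {next L} eq)) (ν-next L i)
... | true with ≡ᵇ-true i i′ eq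
...   | refl = +-cancelʳ-≡ (bit (flag i L)) _ _
        (trans (ν-emit (flag i L) k i _ (next L))
        (trans (cong suc (ν-next L i))
        (sym (cong (_+ bit (flag i L)) (trans (+-identityʳ _) (trans (length-++ (news (suc i) L)) (+-comm _ 1)))))))
ν-next (mul k i′ j ∷ L) i with i ≡ᵇ i′ in eq
... | false = trans (cong length (news-emit-≢ (flag i′ L) {k} {i} {i′} {ν L (suc i′)} {next L} eq)) (ν-next L i)
... | true with ≡ᵇ-true i i′ eq
...   | refl = +-cancelʳ-≡ (bit (flag i L)) _ _
        (trans (ν-emit (flag i L) k i _ (next L))
        (trans (cong suc (ν-next L i))
        (sym (cong (_+ bit (flag i L)) (+-comm _ 1)))))

ν-next-≥ : ∀ L i → ν L (suc i) ≤ ν (next L) i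
ν-next-≥ L i = subst (ν L (suc i) ≤_) (sym (ν-next L i)) (m≤m+n _ _)

module _ {ℓ : ℕ} where

  ν-mono : ∀ {L} → Valid ℓ L → Mono (ν L)
  ν-mono [] i = z≤n
  ν-mono {mul k i′ j ∷ L} (ok ∷ v) i = ν-mono v i
  ν-mono {new k i′ j ∷ L} (ok ∷ v) i with suc i ≟ i′ | i ≟ i′
  ... | yes refl | _ rewrite ν-same k (suc i) j L | ν-diff k {i} (suc i) j L (λ ()) = proj₂ (proj₂ ok)
  ... | no ≢₁ | yes refl rewrite ν-same k i j L | ν-diff k {suc i} i j L ≢₁ = m≤n⇒m≤1+n (ν-mono v i)
  ... | no ≢₁ | no ≢₂ rewrite ν-diff k {i} i′ j L ≢₂ | ν-diff k {suc i} i′ j L ≢₁ = ν-mono v i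

  Ok-row : ∀ {n} e → Ok ℓ n e → row e < ℓ
  Ok-row (new k zero j) (_ , lt) = lt
  Ok-row (new k (suc i) j) (_ , lt , _) = lt
  Ok-row (mul k i j) (_ , _ , lt) = lt

  ν-top : ∀ {L} → Valid ℓ L → ν L ℓ ≡ 0
  ν-top [] = refl
  ν-top {new k i j ∷ L} (ok ∷ v) = trans (ν-diff k i j L (>⇒≢ (Ok-row (new k i j) ok))) (ν-top v)
  ν-top {mul k i j ∷ L} (ok ∷ v) = ν-top v

  -- The addition that set the flag was at the top of its column, beyond the end of row `suc i` but
  -- inside row `i`; since then row `suc i` has not grown.
  flag-< : ∀ {L} → Valid ℓ L → ∀ i → flag i L ≡ true → ν L (suc i) < ν L i
  flag-< {new k zero j ∷ L} (ok ∷ v) zero fl = ≤-trans (flag-< v 0 fl) (≤-trans (n≤1+n _) (≤-reflexive (sym (ν-same k 0 j L))))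
  flag-< {new k zero j ∷ L} (ok ∷ v) (suc i) fl = flag-< v (suc i) fl
  flag-< {new k (suc i′) j ∷ L} (ok ∷ v) i fl with i ≡ᵇ i′
  ... | false with i ≡ᵇ suc i′
  ...   | false = flag-< v i fl
  ...   | true = ≤-trans (flag-< v i fl) (≤-trans (m≤m+n _ _) (≤-reflexive (sym (length-++ (news i L)))))
  flag-< {mul k i′ j ∷ L} (ok ∷ v) i fl with i ≡ᵇ i′ in eq
  ... | false = flag-< v i fl
  ... | true with ≡ᵇ-true i i′ eq
  ...   | refl = ≤-<-trans (proj₁ ok) (proj₁ (proj₂ ok))

  -- Together with `ν-next-≥`, the emitted shape interlaces with the shape of `L`; this is what
  -- makes emitted events satisfy `Ok`.
  ν-next-≤ : ∀ {L} → Valid ℓ L → ∀ i → ν (next L) i ≤ ν L i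
  ν-next-≤ {L} v i rewrite ν-next L i with flag i L in fl
  ... | false = subst (_≤ ν L i) (sym (+-identityʳ _)) (ν-mono v i)
  ... | true = subst (_≤ ν L i) (+-comm 1 _) (flag-< v i fl)

  emit-Ok : ∀ {L} → Valid ℓ L → ∀ k i → ν L (suc i) < ν L i → i < ℓ →
            Ok ℓ (ν (next L)) (emit (flag i L) k i (ν L (suc i)))
  emit-Ok {L} v k i lt i<ℓ with flag i L in fl | ν-next L i
  emit-Ok v k zero lt i<ℓ | false | eq = sym (trans eq (+-identityʳ _)) , i<ℓ
  emit-Ok {L} v k (suc i) lt i<ℓ | false | eq =
    sym eq′ , i<ℓ , subst (_< ν (next L) i) (sym eq′) (≤-trans lt (ν-next-≥ L i))
    where
    eq′ = trans eq (+-identityʳ _)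
  emit-Ok v k i lt i<ℓ | true | eq = ν-next-≤ v (suc i) , ≤-reflexive (trans (+-comm 1 _) (sym eq)) , i<ℓ

  next-Valid : ∀ {L} → Valid ℓ L → Valid ℓ (next L)
  next-Valid [] = []
  next-Valid {new k zero j ∷ L} (ok ∷ v) = next-Valid v
  next-Valid {new k (suc i) j ∷ L} ((_ , i<ℓ , lt) ∷ v) = emit-Ok v k i lt (<-trans (n<1+n i) i<ℓ) ∷ next-Valid v
  next-Valid {mul k i j ∷ L} ((le , lt , i<ℓ) ∷ v) = emit-Ok v k i (≤-<-trans le lt) i<ℓ ∷ next-Valid v

-- Insertion of a whole word, one row of the tableaux at a time

level : ℕ → List Event → List Event
level zero L = L
level (suc r) L = level r (next L)

level-[] : ∀ r → level r [] ≡ []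
level-[] zero = refl
level-[] (suc r) = level-[] r

module _ (ℓ : ℕ) where

  word : List Event → List (ℕ × ℕ)
  word = map (λ e → lab e , content ℓ e)

  insertWord : List (ℕ × ℕ) → List (List ℕ) × List (List ℕ)
  insertWord = foldr (λ p acc → starIns (proj₁ p) (proj₂ p) (proj₁ acc) (proj₂ acc)) ([] , [])

  private
    ℓ+j∸i+i : ∀ {i j} → i < ℓ → (ℓ + j) ∸ i + i ≡ ℓ + j
    ℓ+j∸i+i {i} {j} i<ℓ = m∸n+n≡m (≤-trans (<⇒≤ i<ℓ) (m≤m+n ℓ j))

    starIns-emit : ∀ b k i j P Q → let e = emit b k i j in
                   starIns (lab e) (content ℓ e) P Q ≡ starIns k ((ℓ + j) ∸ i) P Q
    starIns-emit false k i j P Q = refl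
    starIns-emit true k i j P Q = refl

  module _ {L R} (v : Valid ℓ L) (b : BottomRow ℓ (ν L) R) where
    open BottomRow b
    private
      mono = ν-mono v
      top = ν-top v

    append-row : ∀ k → 0 < ℓ → let x = ℓ + ν L 0 in
                 All (_< x) R × BottomRow ℓ (ν (new k 0 (ν L 0) ∷ L)) (R ++ [ x ])
    append-row k 0<ℓ = nthM-All R below , record
      { len = trans (length-++ R) (trans (+-comm _ 1) (trans (cong suc len) (sym (ν-same k 0 (ν L 0) L))))
      ; val = val′ }
      where
      below : ∀ j v → nthM R j ≡ just v → v < ℓ + ν L 0
      below j w eq with nthM-block ℓ mono top b j eq
      ... | i , le , lt , sum = ≤-<-trans (≤-trans (m≤m+n w i) (≤-reflexive sum))
                                          (+-monoʳ-< ℓ (subst (j <_) len (nthM-< R j eq)))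
      val′ : ∀ i j → ν (new k 0 (ν L 0) ∷ L) (suc i) ≤ j → j < ν (new k 0 (ν L 0) ∷ L) i →
             ∃ λ v → nthM (R ++ [ ℓ + ν L 0 ]) j ≡ just v × v + i ≡ ℓ + j
      val′ zero j le lt with m≤n⇒m<n∨m≡n (s≤s⁻¹ (subst (j <_) (ν-same k 0 (ν L 0) L) lt))
      ... | inj₁ lt′ with val zero j le lt′
      ...   | w , eq , sum = w , trans (nthM-++ˡ R _ (nthM-< R j eq)) eq , sum
      val′ zero j le lt | inj₂ refl = ℓ + ν L 0 ,
        subst (λ z → nthM (R ++ [ ℓ + ν L 0 ]) z ≡ _) len (nthM-middle R _ []) , +-identityʳ _
      val′ (suc i) j le lt with val (suc i) j le lt
      ... | w , eq , sum = w , trans (nthM-++ˡ R _ (nthM-< R j eq)) eq , sum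

    -- Column `j` has its top cell in row `i`, so its entry `y` is `x + 1`. Columns to the left
    -- reach row `suc i` and carry entries below `x`; columns to the right end in row `i` or lower
    -- and carry entries above `y`.
    bump-row : ∀ k i → suc i < ℓ → ν L (suc i) < ν L i →
               let j = ν L (suc i) ; x = (ℓ + j) ∸ suc i ; y = (ℓ + j) ∸ i in
               ∃ λ S → ∃ λ U → R ≡ S ++ y ∷ U × All (_< x) S × x < y × All (x <_) U ×
               BottomRow ℓ (ν (new k (suc i) j ∷ L)) (S ++ x ∷ U)
    bump-row k i i<ℓ lt with val i (ν L (suc i)) ≤-refl lt
    ... | y , eq , sum with nthM-split R (ν L (suc i)) eq
    ... | S , U , refl , lenS = S , U , cong (λ z → S ++ z ∷ U) y≡ ,
          nthM-All S left , x<y′ , nthM-All U right , record { len = len′ ; val = val′ }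
      where
      j = ν L (suc i)
      x = (ℓ + j) ∸ suc i
      y≡ : y ≡ (ℓ + j) ∸ i
      y≡ = trans (sym (m+n∸n≡m y i)) (cong (_∸ i) sum)
      x+ : x + suc i ≡ ℓ + j
      x+ = ℓ+j∸i+i i<ℓ
      y≡sucx : y ≡ suc x
      y≡sucx = +-cancelʳ-≡ i y (suc x) (trans sum (trans (sym x+) (+-suc x i)))
      x<y : x < y
      x<y = ≤-reflexive (sym y≡sucx)
      x<y′ = subst (x <_) y≡ x<y
      left : ∀ j′ v → nthM S j′ ≡ just v → v < x
      left j′ w eq′ = +-cancelʳ-< (suc i) w x
        (≤-<-trans (left-bound ℓ mono top b i j′ (subst (j′ <_) lenS (nthM-< S j′ eq′))
                     (trans (nthM-++ˡ S _ (nthM-< S j′ eq′)) eq′))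
                   (subst (ℓ + j′ <_) (sym x+) (+-monoʳ-< ℓ (subst (j′ <_) lenS (nthM-< S j′ eq′)))))
      right : ∀ j′ v → nthM U j′ ≡ just v → x < v
      right j′ w eq′ = <-trans x<y (+-cancelʳ-< i y w
        (<-≤-trans (subst (_< ℓ + (length S + suc j′)) (sym sum)
                      (+-monoʳ-< ℓ (subst (_< length S + suc j′) lenS (m<m+n (length S) (s≤s z≤n)))))
                   (right-bound ℓ mono top b i (length S + suc j′)
                      (subst (_≤ length S + suc j′) lenS (m≤m+n _ _))
                      (trans (nthM-++ʳ S (y ∷ U) (suc j′)) eq′))))
      len′ : length (S ++ x ∷ U) ≡ ν L 0
      len′ = trans (length-++ S) (trans (sym (length-++ S)) len)
      n′ = ν (new k (suc i) j ∷ L)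
      n′-same : n′ (suc i) ≡ suc j
      n′-same = ν-same k (suc i) j L
      x-at : nthM (S ++ x ∷ U) j ≡ just x
      x-at = subst (λ z → nthM (S ++ x ∷ U) z ≡ just x) lenS (nthM-middle S x U)
      old : ∀ i′ j′ → j′ ≢ j → (∃ λ v → nthM R j′ ≡ just v × v + i′ ≡ ℓ + j′) →
            ∃ λ v → nthM (S ++ x ∷ U) j′ ≡ just v × v + i′ ≡ ℓ + j′
      old i′ j′ j′≢ (w , eq′ , s) = w , trans (nthM-replace S x y U (λ e → j′≢ (trans e lenS))) eq′ , s
      val′ : ∀ i′ j′ → n′ (suc i′) ≤ j′ → j′ < n′ i′ →
             ∃ λ v → nthM (S ++ x ∷ U) j′ ≡ just v × v + i′ ≡ ℓ + j′
      val′ i′ j′ le lt′ with i′ ≟ suc i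
      ... | yes refl with m≤n⇒m<n∨m≡n (s≤s⁻¹ (subst (j′ <_) n′-same lt′))
      ...   | inj₂ refl = x , x-at , x+
      ...   | inj₁ j′<j = old i′ j′ (<⇒≢ j′<j)
                            (val i′ j′ (subst (_≤ j′) (ν-diff k (suc i) j L (λ ())) le) j′<j)
      val′ i′ j′ le lt′ | no i′≢ with i′ ≟ i
      ... | yes refl = old i′ j′ (>⇒≢ (subst (_≤ j′) n′-same le))
                         (val i′ j′ (≤-trans (n≤1+n _) (subst (_≤ j′) n′-same le))
                                    (subst (j′ <_) (ν-diff k (suc i) j L i′≢) lt′))
      ... | no i′≢i = old i′ j′ j′≢j (val i′ j′ le″ lt″)
        where
        le″ : ν L (suc i′) ≤ j′
        le″ = subst (_≤ j′) (ν-diff k (suc i) j L (i′≢i ∘ suc-injective)) le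
        lt″ : j′ < ν L i′
        lt″ = subst (j′ <_) (ν-diff k (suc i) j L i′≢) lt′
        j′≢j : j′ ≢ j
        j′≢j refl with i′ ≤? i
        ... | yes i′≤i = <⇒≱ (≤-<-trans (antitone mono {suc i′} {i} (≤∧≢⇒< i′≤i i′≢i)) (≤-<-trans le″ lt)) ≤-refl
        ... | no i′≰i = <⇒≱ lt″ (antitone mono (≰⇒> i′≰i))

    -- The columns whose top cell is in row `i` carry consecutive integers, and this run starts in
    -- column `ν L (suc i)`. The entries of columns further left stay below the integer just before
    -- the run.
    walk-row : ∀ i j → ν L (suc i) ≤ j → j < ν L i → i < ℓ →
               (ℓ + j) ∸ i ∈ R × walkDown R ((ℓ + j) ∸ i) ≡ (ℓ + ν L (suc i)) ∸ i
    walk-row i j le lt i<ℓ = ∈R j le lt ,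
        trans (cong (walkDown R) split) (trans (walkDown-≡ R y d between nthM∉) (sym y≡))
      where
      j₀ = ν L (suc i)
      d = j ∸ j₀
      -- The integer just before the run; `i < ℓ` keeps this subtraction exact.
      y = ℓ + j₀ ∸ suc i
      ∈R : ∀ j → j₀ ≤ j → j < ν L i → (ℓ + j) ∸ i ∈ R
      ∈R j le lt with val i j le lt
      ... | w , eq , sum = subst (_∈ R) (trans (sym (m+n∸n≡m w i)) (cong (_∸ i) sum)) (nthM-∈ R j eq)
      y+ : y + suc i ≡ ℓ + j₀
      y+ = m∸n+n≡m (≤-trans i<ℓ (m≤m+n ℓ j₀))
      y≡ : ℓ + j₀ ∸ i ≡ suc y
      y≡ = +-cancelʳ-≡ i _ _ (trans (ℓ+j∸i+i i<ℓ) (trans (sym y+) (+-suc y i)))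
      at : ∀ c → c + suc y ≡ (ℓ + (c + j₀)) ∸ i
      at c = +-cancelʳ-≡ i _ _ (trans (+-assoc c (suc y) i)
        (trans (cong (c +_) (trans (sym (+-suc y i)) y+))
        (trans (x∙yz≈y∙xz c ℓ j₀) (sym (ℓ+j∸i+i i<ℓ)))))
        where
        x∙yz≈y∙xz : ∀ a b c → a + (b + c) ≡ b + (a + c)
        x∙yz≈y∙xz a b c = trans (sym (+-assoc a b c)) (trans (cong (_+ c) (+-comm a b)) (+-assoc b a c))
      split : (ℓ + j) ∸ i ≡ d + suc y
      split = sym (trans (at d) (cong (λ z → (ℓ + z) ∸ i) (m∸n+n≡m le)))
      between : ∀ c → c < d → (c + suc y) ∈ R
      between c c<d = subst (_∈ R) (sym (at c)) (∈R (c + j₀) (m≤n+m j₀ c)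
        (<-trans (subst (c + j₀ <_) (m∸n+n≡m le) (+-monoˡ-< j₀ c<d)) lt))
      nthM∉ : All (y ≢_) R
      nthM∉ = nthM-All R h
        where
        h : ∀ j′ v → nthM R j′ ≡ just v → y ≢ v
        h j′ w eq refl with j′ <? j₀
        ... | yes j′<j₀ = <⇒≱ (+-monoʳ-< ℓ j′<j₀) (≤-trans (≤-reflexive (sym y+)) (left-bound ℓ mono top b i j′ j′<j₀ eq))
        ... | no j′≮j₀ = <⇒≱ (subst (y + i <_) y+ (+-monoʳ-< y (n<1+n i)))
                (≤-trans (+-monoʳ-≤ ℓ (≮⇒≥ j′≮j₀)) (right-bound ℓ mono top b i j′ (≮⇒≥ j′≮j₀) eq))

  insert-step : ∀ {e L} → Ok ℓ (ν L) e → Valid ℓ L → ∀ {R} → BottomRow ℓ (ν L) R →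
    let (P , Q) = consBoth R (news 0 L) (insertWord (word (next L))) in
    ∃ λ R′ → BottomRow ℓ (ν (e ∷ L)) R′ ×
    starIns (lab e) (content ℓ e) P Q ≡ consBoth R′ (news 0 (e ∷ L)) (insertWord (word (next (e ∷ L))))
  insert-step {new k zero j} {L} (refl , 0<ℓ) v b with append-row v b k 0<ℓ
  ... | R<x , b′ = _ , b′ , starIns-append k _ _ _ R<x
  insert-step {new k (suc i) j} {L} (refl , i<ℓ , lt) v b with bump-row v b k i i<ℓ lt
  ... | S , U , refl , S<x , x<y , x<U , b′ = _ , b′ , trans (starIns-bump k U _ _ _ S<x x<y x<U)
        (sym (cong (consBoth _ (news 0 L))
          (starIns-emit (flag i L) k i (ν L (suc i)) (proj₁ (insertWord (word (next L))))
            (proj₂ (insertWord (word (next L)))))))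
  insert-step {mul k i j} {L} (le , lt , i<ℓ) v b with walk-row v b i j le lt i<ℓ
  ... | x∈R , walk = _ , b , trans (starIns-walk k _ _ _ x∈R walk)
        (sym (cong (consBoth _ (news 0 L))
          (starIns-emit (flag i L) k i (ν L (suc i)) (proj₁ (insertWord (word (next L))))
            (proj₂ (insertWord (word (next L)))))))

  -- Before the first letter the tableaux are `[]` and not a single empty row, hence the disjunct;
  -- `starIns` gives the same result on both.
  insert-factors : ∀ {L} → Valid ℓ L → ∃ λ R → BottomRow ℓ (ν L) R ×
    (L ≡ [] ⊎ insertWord (word L) ≡ consBoth R (news 0 L) (insertWord (word (next L))))
  insert-factors [] = [] , record { len = refl ; val = λ i j le () } , inj₁ refl
  insert-factors (ok ∷ v) with insert-factors v
  ... | R , b , inj₂ eq with insert-step ok v b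
  ...   | R′ , b′ , eq′ = R′ , b′ , inj₂ (trans (cong (λ (P , Q) → starIns _ _ P Q) eq) eq′)
  insert-factors (ok ∷ []) | [] , b , inj₁ refl with insert-step ok [] b
  ...   | R′ , b′ , eq′ = R′ , b′ , inj₂ eq′
  insert-factors (ok ∷ []) | _ ∷ _ , b , inj₁ refl with BottomRow.len b
  ... | ()

  recording-row : ∀ r {L} → Valid ℓ L → nthD [] (proj₂ (insertWord (word L))) r ≡ news 0 (level r L)
  recording-row r v with insert-factors v
  ... | _ , _ , inj₁ refl rewrite level-[] r = refl
  recording-row zero v | _ , _ , inj₂ eq = cong (λ PQ → nthD [] (proj₂ PQ) 0) eq
  recording-row (suc r) v | _ , _ , inj₂ eq =
    trans (cong (λ PQ → nthD [] (proj₂ PQ) (suc r)) eq) (recording-row r (next-Valid v))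

-- Uncrowding

reverse⁺ : ∀ {A : Set} {P : A → Set} {xs} → All P xs → All P (reverse xs)
reverse⁺ ps = All.tabulate (All.lookup ps ∘ Anyₚ.reverse⁻)

-- Row r of the uncrowding of a tableau whose row i has least entries M i and
-- remaining entries D i (decreasing). One round inserts each D i into the row above
-- only, without waiting for higher rows to be uncrowded; what it bumps is inserted
-- in later rounds.
rowAfter : ℕ → (ℕ → List ℕ) → (ℕ → List ℕ) → List ℕ
rowAfter zero M D = M 0
rowAfter (suc r) M D = rowAfter r (λ i → bumps₁ (M (suc i)) (D i)) (λ i → bumps₂ (M (suc i)) (D i))

rowAfter-cong : ∀ r {M M′ D D′} → (∀ i → M i ≡ M′ i) → (∀ i → D i ≡ D′ i) →
                rowAfter r M D ≡ rowAfter r M′ D′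
rowAfter-cong zero eqM eqD = eqM 0
rowAfter-cong (suc r) eqM eqD =
  rowAfter-cong r (λ i → cong₂ bumps₁ (eqM (suc i)) (eqD i)) (λ i → cong₂ bumps₂ (eqM (suc i)) (eqD i))

rowAfter-[] : ∀ r → rowAfter r (λ _ → []) (λ _ → []) ≡ []
rowAfter-[] zero = refl
rowAfter-[] (suc r) = rowAfter-[] r

rowAfter-level : ∀ r {L} → Ordered L → rowAfter r (λ i → news i L) (λ i → muls i L) ≡ news 0 (level r L)
rowAfter-level zero o = refl
rowAfter-level (suc r) {L} o =
  trans (rowAfter-cong r (proj₁ ∘ bumps-next L o) (proj₂ ∘ bumps-next L o)) (rowAfter-level r (next-Ordered o))

-- Insertion of `D` into the rows `X`, organised by rows: all of `D` goes into one row before the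
-- letters bumped out, in their order, go into the next. By `insertAll-++` this is the same as
-- inserting letter by letter.
insertAll : List ℕ → (ℕ → List ℕ) → ℕ → List ℕ
insertAll D X zero = bumps₁ (X 0) D
insertAll D X (suc r) = insertAll (bumps₂ (X 0) D) (X ∘ suc) r

insertAll-cong : ∀ D {X Y} r → (∀ i → X i ≡ Y i) → insertAll D X r ≡ insertAll D Y r
insertAll-cong D zero eq = cong (λ Z → bumps₁ Z D) (eq 0)
insertAll-cong D {Y = Y} (suc r) eq rewrite eq 0 = insertAll-cong (bumps₂ (Y 0) D) r (eq ∘ suc)

insertAll-[] : ∀ X r → insertAll [] X r ≡ X r
insertAll-[] X zero = refl
insertAll-[] X (suc r) = insertAll-[] (X ∘ suc) r

insertAll-++ : ∀ D D′ X r → insertAll (D ++ D′) X r ≡ insertAll D′ (insertAll D X) r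
insertAll-++ D D′ X zero = bumps₁-++ (X 0) D D′
insertAll-++ D D′ X (suc r) rewrite bumps₂-++ (X 0) D D′ = insertAll-++ (bumps₂ (X 0) D) _ (X ∘ suc) r

infixr 5 _◂_
_◂_ : {A : Set} → A → (ℕ → A) → ℕ → A
(a ◂ f) zero = a
(a ◂ f) (suc i) = f i

-- Reconciles uncrowding from the top row downwards with simultaneous rounds: either way row `i + 1`
-- receives `D i` before the letters bumped out of row `i`. The list `I` acts as the remaining
-- entries of a row placed beneath row 0.
insertAll-rowAfter : ∀ r I M D → insertAll I (λ q → rowAfter q M D) r ≡
  rowAfter r (λ i → bumps₁ (M i) ((I ◂ D) i)) (λ i → bumps₂ (M i) ((I ◂ D) i))
insertAll-rowAfter zero I M D = refl
insertAll-rowAfter (suc r) I M D =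
  trans (insertAll-rowAfter r (bumps₂ (M 0) I) _ _)
        (rowAfter-cong r (λ i → cong (bumps₁ (bumps₁ (M (suc i)) (D i))) (eq i))
                         (λ i → cong (bumps₂ (bumps₁ (M (suc i)) (D i))) (eq i)))
  where
  eq : ∀ i → (bumps₂ (M 0) I ◂ (λ i → bumps₂ (M (suc i)) (D i))) i ≡ bumps₂ (M i) ((I ◂ D) i)
  eq zero = refl
  eq (suc i) = refl

-- Subtracting the length of `mu` from all entries

module _ (n : ℕ) where

  -- The bound is on the inserted letter alone: an entry `y` below `n` truncates to 0 and is still
  -- not bumped.
  ∸-<ᵇ : ∀ {x} y → n ≤ x → (x ∸ n <ᵇ y ∸ n) ≡ (x <ᵇ y)
  ∸-<ᵇ {x} y n≤x with x <? y
  ... | yes x<y = trans (<ᵇ-true (∸-monoˡ-< x<y n≤x)) (sym (<ᵇ-true x<y))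
  ... | no x≮y = trans (<ᵇ-false (∸-monoˡ-≤ n (≮⇒≥ x≮y))) (sym (<ᵇ-false (≮⇒≥ x≮y)))

  bump₁-map : ∀ {x} M → n ≤ x → bump₁ (x ∸ n) (map (_∸ n) M) ≡ map (_∸ n) (bump₁ x M)
  bump₁-map [] n≤x = refl
  bump₁-map {x} (y ∷ M) n≤x rewrite ∸-<ᵇ y n≤x with x <ᵇ y
  ... | true = refl
  ... | false = cong (y ∸ n ∷_) (bump₁-map M n≤x)

  bump₂-map : ∀ {x} M → n ≤ x → bump₂ (x ∸ n) (map (_∸ n) M) ≡ map (_∸ n) (bump₂ x M)
  bump₂-map [] n≤x = refl
  bump₂-map {x} (y ∷ M) n≤x rewrite ∸-<ᵇ y n≤x with x <ᵇ y
  ... | true = refl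
  ... | false = bump₂-map M n≤x

  bumps₁-map : ∀ M {D} → All (n ≤_) D → bumps₁ (map (_∸ n) M) (map (_∸ n) D) ≡ map (_∸ n) (bumps₁ M D)
  bumps₁-map M [] = refl
  bumps₁-map M {x ∷ D} (n≤x ∷ ps) rewrite bump₁-map M n≤x = bumps₁-map (bump₁ x M) ps

  bumps₂-map : ∀ M {D} → All (n ≤_) D → bumps₂ (map (_∸ n) M) (map (_∸ n) D) ≡ map (_∸ n) (bumps₂ M D)
  bumps₂-map M [] = refl
  bumps₂-map M {x ∷ D} (n≤x ∷ ps) rewrite bump₁-map M n≤x | bump₂-map M n≤x | bumps₂-map (bump₁ x M) ps =
    sym (map-++ (_∸ n) (bump₂ x M) _)

  bump₂-All : ∀ {x} M → n ≤ x → All (n ≤_) (bump₂ x M)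
  bump₂-All [] n≤x = []
  bump₂-All {x} (y ∷ M) n≤x with x <ᵇ y in eq
  ... | true = ≤-trans n≤x (<⇒≤ (<ᵇ⇒< x y (subst T (sym eq) tt))) ∷ []
  ... | false = bump₂-All M n≤x

  bumps₂-All : ∀ M {D} → All (n ≤_) D → All (n ≤_) (bumps₂ M D)
  bumps₂-All M [] = []
  bumps₂-All M {x ∷ D} (n≤x ∷ ps) = Allₚ.++⁺ (bump₂-All M n≤x) (bumps₂-All (bump₁ x M) ps)

  rowAfter-map : ∀ r M D → (∀ i → All (n ≤_) (D i)) →
                 rowAfter r (map (_∸ n) ∘ M) (map (_∸ n) ∘ D) ≡ map (_∸ n) (rowAfter r M D)
  rowAfter-map zero M D ge = refl
  rowAfter-map (suc r) M D ge =
    trans (rowAfter-cong r (λ i → bumps₁-map (M (suc i)) (ge i)) (λ i → bumps₂-map (M (suc i)) (ge i)))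
          (rowAfter-map r _ _ (λ i → bumps₂-All (M (suc i)) (ge i)))

-- Cells of μ are encoded by the entry 0, which insertion of positive letters never
-- bumps.
record Padded (a : ℕ) (X : List ℕ) : Set where
  constructor padded
  field
    positives : List ℕ
    eq : X ≡ replicate a 0 ++ positives
    pos : All (1 ≤_) positives

bump₁-Padded : ∀ {a x X} → 1 ≤ x → Padded a X → Padded a (bump₁ x X)
bump₁-Padded {a} {x} 1≤x (padded N refl pos) =
  padded (bump₁ x N) (bump₁-≥ N (zeros a)) (bump₁-pos N pos)
  where
  zeros : ∀ a → All (_≤ x) (replicate a 0)
  zeros zero = []
  zeros (suc a) = z≤n ∷ zeros a
  bump₁-pos : ∀ N → All (1 ≤_) N → All (1 ≤_) (bump₁ x N)
  bump₁-pos [] [] = 1≤x ∷ []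
  bump₁-pos (y ∷ N) (p ∷ ps) with x <ᵇ y
  ... | true = 1≤x ∷ ps
  ... | false = p ∷ bump₁-pos N ps

bumps₁-Padded : ∀ {a X D} → All (1 ≤_) D → Padded a X → Padded a (bumps₁ X D)
bumps₁-Padded [] p = p
bumps₁-Padded (x>0 ∷ ps) p = bumps₁-Padded ps (bump₁-Padded x>0 p)

rowAfter-Padded : ∀ r {a : ℕ → ℕ} {M D} → (∀ i → Padded (a i) (M i)) → (∀ i → All (1 ≤_) (D i)) →
                  Padded (a r) (rowAfter r M D)
rowAfter-Padded zero pM pD = pM 0
rowAfter-Padded (suc r) {M = M} pM pD =
  rowAfter-Padded r (λ i → bumps₁-Padded (pD i) (pM (suc i))) (λ i → bumps₂-All 1 (M (suc i)) (pD i))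

-- Rows of set-valued tableaux as lists of numbers

encode : Cell → ℕ
encode nothing = 0
encode (just s) = headOr s

decode : ℕ → Cell
decode zero = nothing
decode (suc v) = just [ suc v ]

extras : Cell → List ℕ
extras (just (a ∷ s)) = reverse s
extras _ = []

-- Rightmost cell first and largest entry first: the order in which uncrowding deletes the letters.
rowExtras : Row → List ℕ
rowExtras [] = []
rowExtras (c ∷ cs) = rowExtras cs ++ extras c

WellFormed : Cell → Set
WellFormed nothing = ⊤
WellFormed (just []) = ⊥
WellFormed (just (a ∷ s)) = 1 ≤ a

-- The same letters read off a reversed row, the form on which `popRev` works.
extrasʳ : Row → List ℕ
extrasʳ [] = []
extrasʳ (c ∷ cs) = extras c ++ extrasʳ cs

extrasʳ-++ : ∀ xs ys → extrasʳ (xs ++ ys) ≡ extrasʳ xs ++ extrasʳ ys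
extrasʳ-++ [] ys = refl
extrasʳ-++ (x ∷ xs) ys = trans (cong (extras x ++_) (extrasʳ-++ xs ys)) (sym (++-assoc (extras x) _ _))

extrasʳ-reverse : ∀ r → extrasʳ (reverse r) ≡ rowExtras r
extrasʳ-reverse [] = refl
extrasʳ-reverse (c ∷ cs) rewrite unfold-reverse c cs | extrasʳ-++ (reverse cs) [ c ]
  | extrasʳ-reverse cs | ++-identityʳ (extras c) = refl

init-last : ∀ b s → b ∷ s ≡ initOf (b ∷ s) ++ [ lastOf (b ∷ s) ]
init-last b [] = refl
init-last b (c ∷ s) = cong (b ∷_) (init-last c s)

reverse-last : ∀ b s → reverse (b ∷ s) ≡ lastOf (b ∷ s) ∷ reverse (initOf (b ∷ s))
reverse-last b s = trans (cong reverse (init-last b s)) (reverse-++ (initOf (b ∷ s)) [ lastOf (b ∷ s) ])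

popRev-nothing : ∀ cs → extrasʳ cs ≡ [] → popRev cs ≡ nothing
popRev-nothing [] eq = refl
popRev-nothing (nothing ∷ cs) eq rewrite popRev-nothing cs eq = refl
popRev-nothing (just [] ∷ cs) eq rewrite popRev-nothing cs eq = refl
popRev-nothing (just (a ∷ []) ∷ cs) eq rewrite popRev-nothing cs eq = refl
popRev-nothing (just (a ∷ b ∷ s) ∷ cs) eq with trans (sym (cong (_++ extrasʳ cs) (reverse-last b s))) eq
... | ()

-- The largest letter of a multicell is never its head, so the encoded row is unchanged and the
-- deleted letter is simply the head of the extras.
popRev-just : ∀ {x D} cs → extrasʳ cs ≡ x ∷ D → All WellFormed cs →
              ∃ λ cs′ → popRev cs ≡ just (cs′ , x) × extrasʳ cs′ ≡ D ×
                        map encode cs′ ≡ map encode cs × All WellFormed cs′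
popRev-just (nothing ∷ cs) eq (w ∷ ws) with popRev-just cs eq ws
... | cs′ , e₁ , e₂ , e₃ , ws′ rewrite e₁ = nothing ∷ cs′ , refl , e₂ , cong (0 ∷_) e₃ , w ∷ ws′
popRev-just (just (a ∷ []) ∷ cs) eq (w ∷ ws) with popRev-just cs eq ws
... | cs′ , e₁ , e₂ , e₃ , ws′ rewrite e₁ = just (a ∷ []) ∷ cs′ , refl , e₂ , cong (a ∷_) e₃ , w ∷ ws′
popRev-just (just (a ∷ b ∷ s) ∷ cs) eq (w ∷ ws) with trans (sym (cong (_++ extrasʳ cs) (reverse-last b s))) eq
... | refl = just (a ∷ initOf (b ∷ s)) ∷ cs , refl , refl , refl , w ∷ ws

popRow-nothing : ∀ r → rowExtras r ≡ [] → popRow r ≡ nothing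
popRow-nothing r eq rewrite popRev-nothing (reverse r) (trans (extrasʳ-reverse r) eq) = refl

popRow-just : ∀ {x D} r → rowExtras r ≡ x ∷ D → All WellFormed r →
              ∃ λ r′ → popRow r ≡ just (r′ , x) × rowExtras r′ ≡ D ×
                       map encode r′ ≡ map encode r × All WellFormed r′
popRow-just r eq ws with popRev-just (reverse r) (trans (extrasʳ-reverse r) eq) (reverse⁺ ws)
... | cs , e₁ , e₂ , e₃ , ws′ rewrite e₁ = reverse cs , refl ,
  trans (sym (extrasʳ-reverse (reverse cs))) (trans (cong extrasʳ (reverse-involutive cs)) e₂) ,
  trans (reverse-map encode cs) (trans (cong reverse e₃)
    (trans (sym (reverse-map encode (reverse r))) (cong (map encode) (reverse-involutive r)))) ,
  reverse⁺ ws′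

decode-encode : ∀ r → rowExtras r ≡ [] → All WellFormed r → map decode (map encode r) ≡ r
decode-encode [] eq [] = refl
decode-encode (nothing ∷ r) eq (_ ∷ ws) = cong (nothing ∷_) (decode-encode r (trans (sym (++-identityʳ _)) eq) ws)
decode-encode (just (suc a ∷ []) ∷ r) eq (_ ∷ ws) = cong (just [ suc a ] ∷_) (decode-encode r (trans (sym (++-identityʳ _)) eq) ws)
decode-encode (just (a ∷ b ∷ s) ∷ r) eq (_ ∷ ws) with rowExtras r | trans (sym (cong (rowExtras r ++_) (reverse-last b s))) eq
... | [] | ()
... | _ ∷ _ | ()

rowExtras-decode : ∀ X → rowExtras (map decode X) ≡ []
rowExtras-decode [] = refl
rowExtras-decode (zero ∷ X) = trans (++-identityʳ _) (rowExtras-decode X)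
rowExtras-decode (suc x ∷ X) = trans (++-identityʳ _) (rowExtras-decode X)

decodeTab : List (List ℕ) → Tab
decodeTab = map (map decode)

uncrowdStep-decode : ∀ Xs → uncrowdStep (decodeTab Xs) ≡ nothing
uncrowdStep-decode [] = refl
uncrowdStep-decode (X ∷ Xs) rewrite uncrowdStep-decode Xs
  | popRow-nothing (map decode X) (rowExtras-decode X) = refl

bumpRow-decode : ∀ x X → bumpRow (suc x) (map decode X) ≡
                 (map decode (bump₁ (suc x) X) , head (bump₂ (suc x) X))
bumpRow-decode x [] = refl
bumpRow-decode x (zero ∷ X) rewrite bumpRow-decode x X = refl
bumpRow-decode x (suc y ∷ X) with x <ᵇ y
... | true = refl
... | false rewrite bumpRow-decode x X = refl

bump₂-cases : ∀ x M → bump₂ x M ≡ [] ⊎ ∃ λ y → x < y × bump₂ x M ≡ [ y ]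
bump₂-cases x [] = inj₁ refl
bump₂-cases x (y ∷ M) with x <ᵇ y in eq
... | true = inj₂ (y , <ᵇ⇒< x y (subst T (sym eq) tt) , refl)
... | false = bump₂-cases x M

insRows-decode : ∀ x Xs → ∃ λ Ys → insRows (suc x) (decodeTab Xs) ≡ decodeTab Ys ×
                 ∀ r → nthD [] Ys r ≡ insertAll [ suc x ] (nthD [] Xs) r
insRows-decode x [] = [ [ suc x ] ] , refl , rows
  where
  rows : ∀ r → nthD [] [ [ suc x ] ] r ≡ insertAll [ suc x ] (nthD [] []) r
  rows zero = refl
  rows (suc r) = sym (insertAll-[] _ r)
insRows-decode x (X ∷ Xs) rewrite bumpRow-decode x X with bump₂-cases (suc x) X
... | inj₁ eq rewrite eq = bump₁ (suc x) X ∷ Xs , refl , rows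
  where
  rows : ∀ r → nthD [] (bump₁ (suc x) X ∷ Xs) r ≡ insertAll [ suc x ] (nthD [] (X ∷ Xs)) r
  rows zero = refl
  rows (suc r) rewrite eq = sym (insertAll-[] _ r)
... | inj₂ (suc y , _ , eq) rewrite eq with insRows-decode y Xs
...   | Ys , e , h rewrite e = bump₁ (suc x) X ∷ Ys , refl , rows
  where
  rows : ∀ r → nthD [] (bump₁ (suc x) X ∷ Ys) r ≡ insertAll [ suc x ] (nthD [] (X ∷ Xs)) r
  rows zero = refl
  rows (suc r) rewrite eq = h r

-- The steps are counted in order to compare them with the fuel given to `uncrowdIter`.
data _⟶[_]_ : Tab → ℕ → Tab → Set where
  done : ∀ {T} → T ⟶[ 0 ] T
  step : ∀ {T T′ T″ n} → uncrowdStep T ≡ just T′ → T′ ⟶[ n ] T″ → T ⟶[ suc n ] T″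

⟶-trans : ∀ {T T′ T″ n n′} → T ⟶[ n ] T′ → T′ ⟶[ n′ ] T″ → T ⟶[ n + n′ ] T″
⟶-trans done t = t
⟶-trans (step e s) t = step e (⟶-trans s t)

⟶-above : ∀ r {T T′ n} → T ⟶[ n ] T′ → (r ∷ T) ⟶[ n ] (r ∷ T′)
⟶-above r done = done
⟶-above r (step {T} {T′} e s) = step lift (⟶-above r s)
  where
  lift : uncrowdStep (r ∷ T) ≡ just (r ∷ T′)
  lift rewrite e = refl

uncrowdIter-⟶ : ∀ {T T′ n} N → T ⟶[ n ] T′ → uncrowdStep T′ ≡ nothing → n ≤ N → uncrowdIter N T ≡ T′
uncrowdIter-⟶ zero done e z≤n = refl
uncrowdIter-⟶ (suc N) done e z≤n rewrite e = refl
uncrowdIter-⟶ (suc N) (step s t) e (s≤s le) rewrite s = uncrowdIter-⟶ N t e le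

uncrowd-row : ∀ D r Xs → rowExtras r ≡ D → All (1 ≤_) D → All WellFormed r →
  ∃ λ Ys → (r ∷ decodeTab Xs) ⟶[ length D ] decodeTab (map encode r ∷ Ys) ×
  ∀ q → nthD [] Ys q ≡ insertAll D (nthD [] Xs) q
uncrowd-row [] r Xs eq [] ws =
  Xs , subst (λ z → (r ∷ decodeTab Xs) ⟶[ 0 ] (z ∷ decodeTab Xs)) (sym (decode-encode r eq ws)) done ,
  λ q → sym (insertAll-[] _ q)
uncrowd-row (suc x ∷ D) r Xs eq (_ ∷ ps) ws with popRow-just r eq ws | insRows-decode x Xs
... | r′ , e₁ , e₂ , e₃ , ws′ | Ys , e , h with uncrowd-row D r′ Ys e₂ ps ws′
... | Zs , steps , h′ = Zs ,
  step first (subst (λ z → (r′ ∷ decodeTab Ys) ⟶[ length D ] decodeTab (z ∷ Zs)) e₃ steps) ,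
  λ q → trans (h′ q) (trans (insertAll-cong D q h) (sym (insertAll-++ [ suc x ] D (nthD [] Xs) q)))
  where
  first : uncrowdStep (r ∷ decodeTab Xs) ≡ just (r′ ∷ decodeTab Ys)
  first rewrite uncrowdStep-decode Xs | e₁ | e = refl

steps : Tab → ℕ
steps [] = 0
steps (r ∷ T) = steps T + length (rowExtras r)

-- When a row is reached, the rows above it are already single-valued, that is, of the form
-- `decodeTab Xs`. Inserting the extras of the row into them is an `insertAll`, which
-- `insertAll-rowAfter` absorbs into one more round.
uncrowd-rows : ∀ T → All (λ r → All (1 ≤_) (rowExtras r) × All WellFormed r) T →
  ∃ λ Ys → T ⟶[ steps T ] decodeTab Ys ×
  ∀ q → nthD [] Ys q ≡ rowAfter q (map encode ∘ rowAt T) (rowExtras ∘ rowAt T)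
uncrowd-rows [] [] = [] , done , λ q → sym (rowAfter-[] q)
uncrowd-rows (r ∷ T) ((pos , wf) ∷ ps) with uncrowd-rows T ps
... | Xs , s , h with uncrowd-row (rowExtras r) r Xs refl pos wf
... | Ys , s′ , h′ = map encode r ∷ Ys , ⟶-trans (⟶-above r s) s′ , rows
  where
  M = map encode ∘ rowAt T
  D = rowExtras ∘ rowAt T
  ◂-rows : ∀ i → (rowExtras r ◂ D) i ≡ rowExtras (rowAt (r ∷ T) i)
  ◂-rows zero = refl
  ◂-rows (suc i) = refl
  rows : ∀ q → nthD [] (map encode r ∷ Ys) q ≡ rowAfter q (map encode ∘ rowAt (r ∷ T)) (rowExtras ∘ rowAt (r ∷ T))
  rows zero = refl
  rows (suc q) = trans (h′ q) (trans (insertAll-cong (rowExtras r) q h)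
    (trans (insertAll-rowAfter q (rowExtras r) M D)
           (rowAfter-cong q (λ i → cong (bumps₁ (M i)) (◂-rows i)) (λ i → cong (bumps₂ (M i)) (◂-rows i)))))

letters-row : ∀ r T → length (rowExtras r) + letters T ≤ letters (r ∷ T)
letters-row [] T = ≤-refl
letters-row (nothing ∷ r) T rewrite ++-identityʳ (rowExtras r) = letters-row r T
letters-row (just [] ∷ r) T rewrite ++-identityʳ (rowExtras r) = letters-row r T
letters-row (just (a ∷ s) ∷ r) T rewrite length-++ (rowExtras r) {reverse s} | length-reverse s
  | +-comm (length (rowExtras r)) (length s) | +-assoc (length s) (length (rowExtras r)) (letters T) =
  m≤n⇒m≤1+n (+-monoʳ-≤ (length s) (letters-row r T))

steps-letters : ∀ T → steps T ≤ letters T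
steps-letters [] = z≤n
steps-letters (r ∷ T) = ≤-trans (+-monoˡ-≤ _ (steps-letters T))
  (≤-trans (≤-reflexive (+-comm (letters T) _)) (letters-row r T))

rowAt-decodeTab : ∀ Xs i → rowAt (decodeTab Xs) i ≡ map decode (nthD [] Xs i)
rowAt-decodeTab [] i = refl
rowAt-decodeTab (X ∷ Xs) zero = refl
rowAt-decodeTab (X ∷ Xs) (suc i) = rowAt-decodeTab Xs i

nthM-map : ∀ {A B : Set} (f : A → B) xs j → nthM (map f xs) j ≡ Maybe.map f (nthM xs j)
nthM-map f [] j = refl
nthM-map f (x ∷ xs) zero = refl
nthM-map f (x ∷ xs) (suc j) = nthM-map f xs j

positive : Maybe ℕ → Maybe ℕ
positive (just (suc v)) = just (suc v)
positive _ = nothing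

uncrowdP-rowAfter : ∀ T → All (λ r → All (1 ≤_) (rowExtras r) × All WellFormed r) T → ∀ i j →
  uncrowdP T i j ≡ positive (nthM (rowAfter i (map encode ∘ rowAt T) (rowExtras ∘ rowAt T)) j)
uncrowdP-rowAfter T ps i j with uncrowd-rows T ps
... | Ys , s , h rewrite uncrowdIter-⟶ (letters T) s (uncrowdStep-decode Ys) (steps-letters T)
  | rowAt-decodeTab Ys i | nthM-map decode (nthD [] Ys i) j | h i
  with nthM (rowAfter i (map encode ∘ rowAt T) (rowExtras ∘ rowAt T)) j
... | nothing = refl
... | just zero = refl
... | just (suc v) = refl

nthM-Padded : ∀ {a X} j → Padded a X → positive (nthM X j) ≡ (if j <ᵇ a then nothing else nthM X j)
nthM-Padded {zero} zero (padded [] refl _) = refl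
nthM-Padded {zero} zero (padded (suc x ∷ N) refl _) = refl
nthM-Padded {zero} zero (padded (zero ∷ N) refl (() ∷ _))
nthM-Padded {zero} (suc j) (padded [] refl _) = refl
nthM-Padded {zero} (suc j) (padded (_ ∷ N) refl (_ ∷ ps)) = nthM-Padded {zero} j (padded N refl ps)
nthM-Padded {suc a} zero (padded N refl _) = refl
nthM-Padded {suc a} (suc j) (padded N refl ps) = nthM-Padded {a} j (padded N refl ps)

-- The residue word

memb⁻ : ∀ {x} R → T (memb x R) → x ∈ R
memb⁻ {x} (y ∷ R) t with Equivalence.to (T-∨ {x ≡ᵇ y}) t
... | inj₁ t′ = here (≡ᵇ⇒≡ x y t′)
... | inj₂ t′ = there (memb⁻ R t′)

anyᵇ⁻ : ∀ {A : Set} (p : A → Bool) xs → T (anyᵇ p xs) → ∃ λ x → x ∈ xs × T (p x)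
anyᵇ⁻ p (x ∷ xs) t with Equivalence.to (T-∨ {p x}) t
... | inj₁ t′ = x , here refl , t′
... | inj₂ t′ with anyᵇ⁻ p xs t′
...   | y , y∈ , t″ = y , there y∈ , t″

anyᵇ⁺ : ∀ {A : Set} (p : A → Bool) {x xs} → x ∈ xs → T (p x) → T (anyᵇ p xs)
anyᵇ⁺ p {xs = y ∷ _} (here refl) t = Equivalence.from (T-∨ {p y}) (inj₁ t)
anyᵇ⁺ p {xs = y ∷ _} (there x∈) t = Equivalence.from (T-∨ {p y}) (inj₂ (anyᵇ⁺ p x∈ t))

cell-≤-max : ∀ {p : ℕ × List ℕ} {cs} → p ∈ cs → proj₁ p ≤ foldr (λ p a → proj₁ p ⊔ a) 0 cs
cell-≤-max {cs = _ ∷ _} (here refl) = m≤m⊔n _ _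
cell-≤-max {cs = q ∷ _} (there p∈) = ≤-trans (cell-≤-max p∈) (m≤n⊔m (proj₁ q) _)

hasEntry : List (ℕ × List ℕ) → ℕ → ℕ → Bool
hasEntry cs k c = anyᵇ (λ p → (c ≡ᵇ proj₁ p) ∧ memb k (proj₂ p)) cs

∈-hfactor⁻ : ∀ cs k {c} → c ∈ hfactor cs k → ∃ λ s → (c , s) ∈ cs × k ∈ s
∈-hfactor⁻ cs k {c} c∈ with anyᵇ⁻ _ cs (proj₂ (∈-filter⁻ (T? ∘ hasEntry cs k) c∈))
... | (c′ , s) , p∈ , t with Equivalence.to (T-∧ {c ≡ᵇ c′}) t
...   | t₁ , t₂ with ≡ᵇ⇒≡ c c′ t₁
...     | refl = s , p∈ , memb⁻ s t₂

∈-hfactor⁺ : ∀ cs k {c s} → (c , s) ∈ cs → k ∈ s → c ∈ hfactor cs k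
∈-hfactor⁺ cs k {c} {s} p∈ k∈ = ∈-filter⁺ (T? ∘ hasEntry cs k)
  (∈-downFrom⁺ (s≤s (cell-≤-max p∈)))
  (anyᵇ⁺ _ p∈ (Equivalence.from (T-∧ {c ≡ᵇ c}) (≡⇒≡ᵇ c c refl , Equivalence.from T-≡ (memb-∈ k∈))))

hfactor-sorted : ∀ cs k → AllPairs _>_ (hfactor cs k)
hfactor-sorted cs k = AllPairsₚ.filter⁺ (T? ∘ hasEntry cs k) (AllPairsₚ.applyDownFrom⁺₁ id _ (λ j<i _ → j<i))

∈-rowCells⁻ : ∀ ℓ i j r {c s} → (c , s) ∈ rowCells ℓ i j r →
              ∃ λ p → nthM r p ≡ just (just s) × c ≡ (ℓ + (j + p)) ∸ i
∈-rowCells⁻ ℓ i j (nothing ∷ r) c∈ with ∈-rowCells⁻ ℓ i (suc j) r c∈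
... | p , eq , refl = suc p , eq , cong (λ z → (ℓ + z) ∸ i) (sym (+-suc j p))
∈-rowCells⁻ ℓ i j (just s ∷ r) (here refl) = 0 , refl , cong (λ z → (ℓ + z) ∸ i) (sym (+-identityʳ j))
∈-rowCells⁻ ℓ i j (just s ∷ r) (there c∈) with ∈-rowCells⁻ ℓ i (suc j) r c∈
... | p , eq , refl = suc p , eq , cong (λ z → (ℓ + z) ∸ i) (sym (+-suc j p))

∈-rowCells⁺ : ∀ ℓ i j r p {s} → nthM r p ≡ just (just s) → ((ℓ + (j + p)) ∸ i , s) ∈ rowCells ℓ i j r
∈-rowCells⁺ ℓ i j (just s ∷ r) zero refl rewrite +-identityʳ j = here refl
∈-rowCells⁺ ℓ i j (nothing ∷ r) (suc p) eq rewrite +-suc j p = ∈-rowCells⁺ ℓ i (suc j) r p eq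
∈-rowCells⁺ ℓ i j (just _ ∷ r) (suc p) eq rewrite +-suc j p = there (∈-rowCells⁺ ℓ i (suc j) r p eq)

∈-allCells⁻ : ∀ ℓ i T {c s} → (c , s) ∈ allCells ℓ i T →
              ∃ λ p → ∃ λ j → nthM (rowAt T p) j ≡ just (just s) × c ≡ (ℓ + j) ∸ (i + p)
∈-allCells⁻ ℓ i (r ∷ T) c∈ with ∈-++⁻ (rowCells ℓ i 0 r) c∈
... | inj₁ c∈r with ∈-rowCells⁻ ℓ i 0 r c∈r
...   | j , eq , refl = 0 , j , eq , cong (ℓ + j ∸_) (sym (+-identityʳ i))
∈-allCells⁻ ℓ i (r ∷ T) c∈ | inj₂ c∈T with ∈-allCells⁻ ℓ (suc i) T c∈T
...   | p , j , eq , refl = suc p , j , eq , cong (ℓ + j ∸_) (sym (+-suc i p))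

∈-allCells⁺ : ∀ ℓ i T p j {s} → nthM (rowAt T p) j ≡ just (just s) → ((ℓ + j) ∸ (i + p) , s) ∈ allCells ℓ i T
∈-allCells⁺ ℓ i (r ∷ T) zero j eq rewrite +-identityʳ i = ∈-++⁺ˡ (∈-rowCells⁺ ℓ i 0 r j eq)
∈-allCells⁺ ℓ i (r ∷ T) (suc p) j eq rewrite +-suc i p =
  ∈-++⁺ʳ (rowCells ℓ i 0 r) (∈-allCells⁺ ℓ (suc i) T p j eq)

nthM-replicate⁻ : ∀ {A : Set} a {x y : A} j → nthM (replicate a x) j ≡ just y → j < a × y ≡ x
nthM-replicate⁻ (suc a) zero refl = s≤s z≤n , refl
nthM-replicate⁻ (suc a) (suc j) eq with nthM-replicate⁻ a j eq
... | lt , eq′ = s≤s lt , eq′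

nthM-replicate⁺ : ∀ {A : Set} {a} {x : A} {j} → j < a → nthM (replicate a x) j ≡ just x
nthM-replicate⁺ {a = suc a} {j = zero} lt = refl
nthM-replicate⁺ {a = suc a} {j = suc j} (s≤s lt) = nthM-replicate⁺ lt

tmuRows⁻ : ∀ i mu p j {c} → nthM (rowAt (tmuRows i mu) p) j ≡ just c → j < part mu p × c ≡ just [ suc (i + p) ]
tmuRows⁻ i (a ∷ mu) zero j eq rewrite +-identityʳ i = nthM-replicate⁻ a j eq
tmuRows⁻ i (a ∷ mu) (suc p) j eq rewrite +-suc i p = tmuRows⁻ (suc i) mu p j eq

tmuRows⁺ : ∀ i mu p {j} → j < part mu p → nthM (rowAt (tmuRows i mu) p) j ≡ just (just [ suc (i + p) ])
tmuRows⁺ i (a ∷ mu) zero lt rewrite +-identityʳ i = nthM-replicate⁺ lt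
tmuRows⁺ i (a ∷ mu) (suc p) lt rewrite +-suc i p = tmuRows⁺ (suc i) mu p lt

_>ₗ_ : ℕ × ℕ → ℕ × ℕ → Set
(q′ , c′) >ₗ (q , c) = q < q′ ⊎ (q ≡ q′ × c < c′)

labelled-≤ : ∀ k hs → All (λ p → proj₁ p ≤ k) (labelled k hs)
labelled-≤ k [] = []
labelled-≤ k (h ∷ hs) = Allₚ.++⁺ (Allₚ.map⁺ (All.universal (λ _ → ≤-refl) h))
                                 (All.map (λ le → ≤-trans le (m∸n≤m k 1)) (labelled-≤ (k ∸ 1) hs))

labelled-sorted : ∀ k hs → length hs ≤ k → All (AllPairs _>_) hs → AllPairs _>ₗ_ (labelled k hs)
labelled-sorted k [] le [] = []
labelled-sorted (suc k) (h ∷ hs) (s≤s le) (p ∷ ps) =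
  AllPairsₚ.++⁺ (AllPairsₚ.map⁺ (AllPairs.map (λ gt → inj₂ (refl , gt)) p)) (labelled-sorted k hs le ps)
    (Allₚ.map⁺ (All.universal (λ _ → All.map (inj₁ ∘ s≤s) (labelled-≤ k hs)) h))

module _ (n : ℕ) (g : ℕ → List ℕ) (hs : List (List ℕ)) where

  -- The shift by `n` that defines `T*` arises from position alone: the factors of `T` stand to the
  -- left of the `n` factors of `Tmu mu`.
  ∈-labelled⁻ : ∀ m {p} → p ∈ labelled (m + n) (map g (downFrom m) ++ hs) →
                (∃ λ k → k < m × proj₁ p ≡ suc k + n × proj₂ p ∈ g k) ⊎ p ∈ labelled n hs
  ∈-labelled⁻ zero p∈ = inj₂ p∈
  ∈-labelled⁻ (suc m) p∈ with ∈-++⁻ (map (suc m + n ,_) (g m)) p∈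
  ... | inj₁ p∈₁ with ∈-map⁻ (suc m + n ,_) p∈₁
  ...   | c , c∈ , refl = inj₁ (m , ≤-refl , refl , c∈)
  ∈-labelled⁻ (suc m) p∈ | inj₂ p∈₂ with ∈-labelled⁻ m p∈₂
  ...   | inj₁ (k , k<m , rest) = inj₁ (k , m≤n⇒m≤1+n k<m , rest)
  ...   | inj₂ p∈hs = inj₂ p∈hs

  ∈-labelled⁺ˡ : ∀ m {k c} → k < m → c ∈ g k → (suc k + n , c) ∈ labelled (m + n) (map g (downFrom m) ++ hs)
  ∈-labelled⁺ˡ (suc m) {k} k<m c∈ with m≤n⇒m<n∨m≡n (s≤s⁻¹ k<m)
  ... | inj₁ k<m′ = ∈-++⁺ʳ (map (suc m + n ,_) (g m)) (∈-labelled⁺ˡ m k<m′ c∈)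
  ... | inj₂ refl = ∈-++⁺ˡ (∈-map⁺ (suc m + n ,_) c∈)

  ∈-labelled⁺ʳ : ∀ m {p} → p ∈ labelled n hs → p ∈ labelled (m + n) (map g (downFrom m) ++ hs)
  ∈-labelled⁺ʳ zero p∈ = p∈
  ∈-labelled⁺ʳ (suc m) p∈ = ∈-++⁺ʳ (map (suc m + n ,_) (g m)) (∈-labelled⁺ʳ m p∈)

-- Lists sorted by a strict order

module _ {A : Set} {R : A → A → Set} where

  AllPairs-zip : ∀ {P : A → Set} {S : A → A → Set} → (∀ {x y} → P x → P y → R x y → S x y) →
                 ∀ {xs} → All P xs → AllPairs R xs → AllPairs S xs
  AllPairs-zip h [] [] = []
  AllPairs-zip h (p ∷ ps) (r ∷ rs) = All.zipWith (λ (py , rxy) → h p py rxy) (ps , r) ∷ AllPairs-zip h ps rs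

  AllPairs-∈ : ∀ {x y xs} → AllPairs R xs → x ∈ xs → y ∈ xs → x ≡ y ⊎ R x y ⊎ R y x
  AllPairs-∈ (r ∷ rs) (here refl) (here refl) = inj₁ refl
  AllPairs-∈ (r ∷ rs) (here refl) (there y∈) = inj₂ (inj₁ (All.lookup r y∈))
  AllPairs-∈ (r ∷ rs) (there x∈) (here refl) = inj₂ (inj₂ (All.lookup r x∈))
  AllPairs-∈ (r ∷ rs) (there x∈) (there y∈) = AllPairs-∈ rs x∈ y∈

  AllPairs-unique : (∀ {x y} → R x y → ¬ R y x) → ∀ {xs ys} → AllPairs R xs → AllPairs R ys →
                    (∀ {z} → z ∈ xs → z ∈ ys) → (∀ {z} → z ∈ ys → z ∈ xs) → xs ≡ ys
  AllPairs-unique asym [] [] f g = refl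
  AllPairs-unique asym [] (r ∷ rs) f g with g (here refl)
  ... | ()
  AllPairs-unique asym (r ∷ rs) [] f g with f (here refl)
  ... | ()
  AllPairs-unique asym {x ∷ xs} {y ∷ ys} (r ∷ rs) (q ∷ qs) f g with f (here refl) | g (here refl)
  ... | there x∈ys | there y∈xs = ⊥-elim (asym (All.lookup r y∈xs) (All.lookup q x∈ys))
  ... | there x∈ys | here refl = ⊥-elim (asym (All.lookup q x∈ys) (All.lookup q x∈ys))
  ... | here refl | _ = cong (x ∷_) (AllPairs-unique asym rs qs f′ g′)
    where
    f′ : ∀ {z} → z ∈ xs → z ∈ ys
    f′ z∈ with f (there z∈)
    ... | there z∈ys = z∈ys
    ... | here refl = ⊥-elim (asym (All.lookup r z∈) (All.lookup r z∈))
    g′ : ∀ {z} → z ∈ ys → z ∈ xs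
    g′ z∈ with g (there z∈)
    ... | there z∈xs = z∈xs
    ... | here refl = ⊥-elim (asym (All.lookup q z∈) (All.lookup q z∈))

  AllPairs-reverse : ∀ {xs} → AllPairs R xs → AllPairs (λ x y → R y x) (reverse xs)
  AllPairs-reverse [] = []
  AllPairs-reverse {x ∷ xs} (r ∷ rs) rewrite unfold-reverse x xs =
    AllPairsₚ.++⁺ (AllPairs-reverse rs) ([] ∷ []) (All.map (_∷ []) (reverse⁺ r))

part-mono : ∀ {p} → IsPartition p → Mono (part p)
part-mono (_ , ps) = go ps
  where
  go : ∀ {p} → AllPairs (λ a b → b ≤ a) p → Mono (part p)
  go [] i = z≤n
  go ([] ∷ []) zero = z≤n
  go ((b≤a ∷ _) ∷ _) zero = b≤a
  go (_ ∷ ps) (suc i) = go ps i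

part-< : ∀ p i {j} → j < part p i → i < length p
part-< (a ∷ p) zero lt = s≤s z≤n
part-< (a ∷ p) (suc i) lt = s≤s (part-< p i lt)

nthM-exists : ∀ {A : Set} (xs : List A) {j} → j < length xs → ∃ λ x → nthM xs j ≡ just x
nthM-exists (x ∷ xs) {zero} lt = x , refl
nthM-exists (x ∷ xs) {suc j} (s≤s lt) = nthM-exists xs lt

nthD-All : ∀ {A : Set} {P : A → Set} {d} xs → (∀ i → P (nthD d xs i)) → All P xs
nthD-All [] h = []
nthD-All (x ∷ xs) h = h 0 ∷ nthD-All xs (h ∘ suc)

>ₗ-asym : ∀ p q → p >ₗ q → ¬ q >ₗ p
>ₗ-asym p q (inj₁ lt) (inj₁ lt′) = <-asym lt lt′
>ₗ-asym p q (inj₁ lt) (inj₂ (eq , _)) = <-irrefl (sym eq) lt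
>ₗ-asym p q (inj₂ (eq , _)) (inj₁ lt) = <-irrefl (sym eq) lt
>ₗ-asym p q (inj₂ (_ , lt)) (inj₂ (_ , lt′)) = <-asym lt lt′

-- Events of a single row

news-++ : ∀ i xs ys → news i (xs ++ ys) ≡ news i ys ++ news i xs
news-++ i [] ys = sym (++-identityʳ _)
news-++ i (new k i′ j ∷ xs) ys with i ≡ᵇ i′
... | false = news-++ i xs ys
... | true = trans (cong (_++ [ k ]) (news-++ i xs ys)) (++-assoc (news i ys) (news i xs) [ k ])
news-++ i (mul k i′ j ∷ xs) ys = news-++ i xs ys

muls-++ : ∀ i xs ys → muls i (xs ++ ys) ≡ muls i xs ++ muls i ys
muls-++ i [] ys = refl
muls-++ i (new k i′ j ∷ xs) ys = muls-++ i xs ys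
muls-++ i (mul k i′ j ∷ xs) ys with i ≡ᵇ i′
... | false = muls-++ i xs ys
... | true = cong (k ∷_) (muls-++ i xs ys)

onRow : ℕ → List Event → List Event
onRow i = filter (λ e → i ≟ row e)

news-onRow : ∀ i L → news i (onRow i L) ≡ news i L
news-onRow i [] = refl
news-onRow i (new k i′ j ∷ L) with i ≡ᵇ i′ in eq
... | false = news-onRow i L
... | true rewrite eq = cong (_++ [ k ]) (news-onRow i L)
news-onRow i (mul k i′ j ∷ L) with i ≡ᵇ i′
... | false = news-onRow i L
... | true = news-onRow i L

muls-onRow : ∀ i L → muls i (onRow i L) ≡ muls i L
muls-onRow i [] = refl
muls-onRow i (mul k i′ j ∷ L) with i ≡ᵇ i′ in eq
... | false = muls-onRow i L
... | true rewrite eq = cong (k ∷_) (muls-onRow i L)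
muls-onRow i (new k i′ j ∷ L) with i ≡ᵇ i′
... | false = muls-onRow i L
... | true = muls-onRow i L

-- The reading order restricted to one row.
_▷_ : Event → Event → Set
e′ ▷ e = col e < col e′ ⊎ (col e ≡ col e′ × lab e < lab e′)

▷-asym : ∀ {x y} → x ▷ y → ¬ y ▷ x
▷-asym {x} {y} = >ₗ-asym (col x , lab x) (col y , lab y)

-- The events of the tableau T*

module Events {m lam mu T} (lamP : IsPartition lam) (muP : IsPartition mu) (sub : mu ⊆ₚ lam)
              (svt : IsSVT m lam mu T) where
  open IsSVT svt

  n ℓ : ℕ
  n = length mu
  ℓ = length lam

  At : ℕ → ℕ → Cell → Set
  At i j c = nthM (rowAt T i) j ≡ just c

  At-cellAt : ∀ {i j c} → At i j c → cellAt T i j ≡ c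
  At-cellAt at rewrite at = refl

  At-< : ∀ {i j c} → At i j c → j < part lam i
  At-< {i} {j} at = subst (j <_) (rowlen i) (nthM-< (rowAt T i) j at)

  At-exists : ∀ {i j} → j < part lam i → ∃ (At i j)
  At-exists {i} {j} lt = nthM-exists (rowAt T i) (subst (j <_) (sym (rowlen i)) lt)

  At-closed : ∀ {i i′ j j′ c′} → i ≤ i′ → j ≤ j′ → At i′ j′ c′ → ∃ (At i j)
  At-closed i≤i′ j≤j′ at = At-exists (≤-<-trans j≤j′ (<-≤-trans (At-< at) (antitone (part-mono lamP) i≤i′)))

  At-row : ∀ {i j c} → At i j c → i < ℓ
  At-row {i} at = part-< lam i (At-< at)

  data Kind (i j : ℕ) : Cell → Set where
    inside : j < part mu i → Kind i j nothing
    outside : ∀ {a s} → part mu i ≤ j → IsEntrySet m (a ∷ s) → Kind i j (just (a ∷ s))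

  kind : ∀ {i j c} → At i j c → Kind i j c
  kind {i} {j} at with j <? part mu i
  ... | yes lt with trans (sym (At-cellAt at)) (inner i j lt)
  ...   | refl = inside lt
  kind {i} {j} at | no ≮ with filled i j (≮⇒≥ ≮) (At-< at)
  ... | s , eq , es with trans (sym (At-cellAt at)) eq
  kind {i} {j} at | no ≮ | (a ∷ s) , eq , es | refl = outside (≮⇒≥ ≮) es
  kind {i} {j} at | no ≮ | [] , eq , (() , _) | refl

  -- The entries of a cell of `T*`; rows count from 0, so row `i` of `Tmu mu` holds `suc i`.
  entries : ℕ → Cell → List ℕ
  entries i nothing = [ suc i ]
  entries i (just s) = map (_+ n) s

  entries-exists : ∀ {i j c} → Kind i j c → ∃ (_∈ entries i c)
  entries-exists (inside _) = _ , here refl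
  entries-exists (outside _ _) = _ , here refl

  entries-mono : ∀ {i j c c′} → At i j c → At i (suc j) c′ → ∀ {a b} → a ∈ entries i c → b ∈ entries i c′ → a ≤ b
  entries-mono {i} at at′ a∈ b∈ with kind at | kind at′
  entries-mono {i} at at′ (here refl) (here refl) | inside _ | inside _ = ≤-refl
  entries-mono {i} at at′ (here refl) b∈ | inside lt | outside _ _ with ∈-map⁻ (_+ n) b∈
  ... | b , _ , refl = ≤-trans (part-< mu i lt) (m≤n+m n b)
  entries-mono {i} {j} at at′ a∈ b∈ | outside le _ | inside lt = ⊥-elim (<⇒≱ (<-trans (n<1+n j) lt) le)
  entries-mono {i} {j} at at′ a∈ b∈ | outside _ _ | outside _ _ with ∈-map⁻ (_+ n) a∈ | ∈-map⁻ (_+ n) b∈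
  ... | a , a∈s , refl | b , b∈s , refl =
    +-monoˡ-≤ n (rowWeak i j _ _ (At-cellAt at) (At-cellAt at′) a b a∈s b∈s)

  entries-strict : ∀ {i j c c′} → At i j c → At (suc i) j c′ → ∀ {a b} → a ∈ entries i c → b ∈ entries (suc i) c′ → a < b
  entries-strict {i} at at′ a∈ b∈ with kind at | kind at′
  entries-strict {i} at at′ (here refl) (here refl) | inside _ | inside _ = ≤-refl
  entries-strict {i} at at′ (here refl) b∈ | inside lt | outside _ (_ , _ , ps) with ∈-map⁻ (_+ n) b∈
  ... | b , b∈s , refl = +-mono-≤ (proj₁ (All.lookup ps b∈s)) (part-< mu i lt)
  entries-strict {i} {j} at at′ a∈ b∈ | outside le _ | inside lt = ⊥-elim (<⇒≱ lt (≤-trans (part-mono muP i) le))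
  entries-strict {i} {j} at at′ a∈ b∈ | outside _ _ | outside _ _ with ∈-map⁻ (_+ n) a∈ | ∈-map⁻ (_+ n) b∈
  ... | a , a∈s , refl | b , b∈s , refl =
    +-monoˡ-< n (colStrict i j _ _ (At-cellAt at) (At-cellAt at′) a b a∈s b∈s)

  -- Chained through the cells in between, which exist because `lam` is a partition and have entries
  -- because no cell of `T*` is empty.
  right-≤ : ∀ {i j j′ c c′} → j < j′ → At i j c → At i j′ c′ → ∀ {a b} → a ∈ entries i c → b ∈ entries i c′ → a ≤ b
  right-≤ {j′ = suc j′} j<j′ at at′ a∈ b∈ with m≤n⇒m<n∨m≡n (s≤s⁻¹ j<j′)
  ... | inj₂ refl = entries-mono at at′ a∈ b∈
  ... | inj₁ lt with At-closed ≤-refl (n≤1+n j′) at′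
  ...   | _ , at″ with entries-exists (kind at″)
  ...     | _ , d∈ = ≤-trans (right-≤ lt at at″ a∈ d∈) (entries-mono at″ at′ d∈ b∈)

  up-< : ∀ {i i′ j c c′} → i < i′ → At i j c → At i′ j c′ → ∀ {a b} → a ∈ entries i c → b ∈ entries i′ c′ → a < b
  up-< {i′ = suc i′} i<i′ at at′ a∈ b∈ with m≤n⇒m<n∨m≡n (s≤s⁻¹ i<i′)
  ... | inj₂ refl = entries-strict at at′ a∈ b∈
  ... | inj₁ lt with At-closed (n≤1+n i′) ≤-refl at′
  ...   | _ , at″ with entries-exists (kind at″)
  ...     | _ , d∈ = <-trans (up-< lt at at″ a∈ d∈) (entries-strict at″ at′ d∈ b∈)

  up-right-< : ∀ {i i′ j j′ c c′} → i < i′ → j ≤ j′ → At i j c → At i′ j′ c′ →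
               ∀ {a b} → a ∈ entries i c → b ∈ entries i′ c′ → a < b
  up-right-< i<i′ j≤j′ at at′ a∈ b∈ with m≤n⇒m<n∨m≡n j≤j′
  ... | inj₂ refl = up-< i<i′ at at′ a∈ b∈
  ... | inj₁ lt with At-closed (<⇒≤ i<i′) ≤-refl at′
  ...   | _ , at″ with entries-exists (kind at″)
  ...     | _ , d∈ = ≤-<-trans (right-≤ lt at at″ a∈ d∈) (up-< i<i′ at″ at′ d∈ b∈)

  cellEvents : ℕ → ℕ → Cell → List Event
  cellEvents i j nothing = [ new (suc i) i j ]
  cellEvents i j (just []) = []
  cellEvents i j (just (a ∷ s)) = map (λ b → mul (b + n) i j) (reverse s) ++ [ new (a + n) i j ]

  cellEvents⁻ : ∀ {i j e} c → e ∈ cellEvents i j c → row e ≡ i × col e ≡ j × lab e ∈ entries i c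
  cellEvents⁻ nothing (here refl) = refl , refl , here refl
  cellEvents⁻ {i} {j} (just (a ∷ s)) e∈ with ∈-++⁻ (map (λ b → mul (b + n) i j) (reverse s)) e∈
  ... | inj₂ (here refl) = refl , refl , here refl
  ... | inj₁ e∈s with ∈-map⁻ (λ b → mul (b + n) i j) e∈s
  ...   | b , b∈ , refl = refl , refl , there (∈-map⁺ (_+ n) (Anyₚ.reverse⁻ b∈))

  cellEvents⁺ : ∀ {i j k} c → k ∈ entries i c → ∃ λ e → e ∈ cellEvents i j c × lab e ≡ k
  cellEvents⁺ nothing (here refl) = _ , here refl , refl
  cellEvents⁺ {i} {j} (just (a ∷ s)) (here refl) = _ , ∈-++⁺ʳ (map (λ b → mul (b + n) i j) (reverse s)) (here refl) , refl
  cellEvents⁺ {i} {j} (just (a ∷ s)) (there k∈) with ∈-map⁻ (_+ n) k∈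
  ... | b , b∈ , refl = _ , ∈-++⁺ˡ (∈-map⁺ (λ b → mul (b + n) i j) (Anyₚ.reverse⁺ b∈)) , refl

  cellEvents-sorted : ∀ {i j c} → Kind i j c → AllPairs _▷_ (cellEvents i j c)
  cellEvents-sorted (inside _) = [] ∷ []
  cellEvents-sorted (outside {a} {s} _ (_ , (a<s ∷ ps) , _)) = AllPairsₚ.++⁺
    (AllPairsₚ.map⁺ (AllPairs.map (λ lt → inj₂ (refl , +-monoˡ-< n lt)) (AllPairs-reverse ps))) ([] ∷ [])
    (Allₚ.map⁺ (All.map (λ lt → inj₂ (refl , +-monoˡ-< n lt) ∷ []) (reverse⁺ a<s)))

  cellEvents-new : ∀ {i j c} → Kind i j c → ∃ λ k → new k i j ∈ cellEvents i j c
  cellEvents-new (inside _) = _ , here refl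
  cellEvents-new {i} {j} (outside {a} {s} _ _) = _ , ∈-++⁺ʳ (map (λ b → mul (b + n) i j) (reverse s)) (here refl)

  new-unique : ∀ {i j k k′} c → new k i j ∈ cellEvents i j c → new k′ i j ∈ cellEvents i j c → k ≡ k′
  new-unique nothing (here refl) (here refl) = refl
  new-unique {i} {j} (just (a ∷ s)) k∈ k′∈ = trans (min k∈) (sym (min k′∈))
    where
    min : ∀ {k} → new k i j ∈ cellEvents i j (just (a ∷ s)) → k ≡ a + n
    min k∈ with ∈-++⁻ (map (λ b → mul (b + n) i j) (reverse s)) k∈
    ... | inj₂ (here refl) = refl
    ... | inj₁ k∈s with ∈-map⁻ (λ b → mul (b + n) i j) k∈s
    ...   | _ , _ , ()

  mul-min : ∀ {i j k c} → Kind i j c → mul k i j ∈ cellEvents i j c →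
            ∃ λ k₀ → k₀ < k × new k₀ i j ∈ cellEvents i j c
  mul-min (inside _) (here ())
  mul-min {i} {j} (outside {a} {s} _ (_ , (a<s ∷ _) , _)) k∈ with ∈-++⁻ (map (λ b → mul (b + n) i j) (reverse s)) k∈
  ... | inj₂ (here ())
  ... | inj₁ k∈s with ∈-map⁻ (λ b → mul (b + n) i j) k∈s
  ...   | b , b∈ , refl = a + n , +-monoˡ-< n (All.lookup a<s (Anyₚ.reverse⁻ b∈)) ,
                          ∈-++⁺ʳ (map (λ b → mul (b + n) i j) (reverse s)) (here refl)

  InT : Event → Set
  InT e = ∃ λ c → At (row e) (col e) c × e ∈ cellEvents (row e) (col e) c

  InT⁺ : ∀ {i j c e} → At i j c → e ∈ cellEvents i j c → InT e
  InT⁺ {c = c} at e∈ with cellEvents⁻ c e∈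
  ... | refl , refl , _ = c , at , e∈

  InT-lab : ∀ {e} → (t : InT e) → lab e ∈ entries (row e) (proj₁ t)
  InT-lab (c , _ , e∈) = proj₂ (proj₂ (cellEvents⁻ c e∈))

  InT-unique : ∀ {e e′} → InT e → InT e′ → row e ≡ row e′ → col e ≡ col e′ → lab e ≡ lab e′ → e ≡ e′
  InT-unique {e} {e′} (c , at , e∈) t′ req ceq leq with cell t′ (sym req) (sym ceq)
    where
    cell : ∀ {e i j} → InT e → row e ≡ i → col e ≡ j → ∃ λ c → At i j c × e ∈ cellEvents i j c
    cell t refl refl = t
  ... | c′ , at′ , e′∈ with just-injective (trans (sym at) at′)
  ... | refl with AllPairs-∈ (cellEvents-sorted (kind at)) e∈ e′∈
  ... | inj₁ eq = eq
  ... | inj₂ (inj₁ (inj₁ lt)) = ⊥-elim (<-irrefl (sym ceq) lt)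
  ... | inj₂ (inj₁ (inj₂ (_ , lt))) = ⊥-elim (<-irrefl (sym leq) lt)
  ... | inj₂ (inj₂ (inj₁ lt)) = ⊥-elim (<-irrefl ceq lt)
  ... | inj₂ (inj₂ (inj₂ (_ , lt))) = ⊥-elim (<-irrefl leq lt)

  key : Event → ℕ × ℕ
  key e = lab e , content ℓ e

  content-+ : ∀ {e} → InT e → content ℓ e + row e ≡ ℓ + col e
  content-+ {e} (_ , at , _) = m∸n+n≡m (≤-trans (<⇒≤ (At-row at)) (m≤m+n ℓ (col e)))

  content-<-col : ∀ {e e′} → InT e → InT e′ → row e ≡ row e′ → content ℓ e < content ℓ e′ → col e < col e′
  content-<-col {e} {e′} t t′ req lt = +-cancelˡ-< ℓ _ _
    (subst₂ _<_ (content-+ t) (trans (cong (content ℓ e′ +_) req) (content-+ t′)) (+-monoˡ-< (row e) lt))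

  -- If `e′` were in a higher row, the contents would also place it weakly to the right, where every
  -- entry of `T*` is strictly larger.
  content-≤-row : ∀ {e e′} → InT e → InT e′ → lab e ≡ lab e′ → content ℓ e ≤ content ℓ e′ → row e′ ≤ row e
  content-≤-row {e} {e′} t@(_ , at , _) t′@(_ , at′ , _) leq le with row e′ ≤? row e
  ... | yes r = r
  ... | no ≰ = ⊥-elim (<-irrefl leq (up-right-< (≰⇒> ≰) cols at at′ (InT-lab t) (InT-lab t′)))
    where
    cols : col e ≤ col e′
    cols = +-cancelˡ-≤ ℓ _ _ (subst₂ _≤_ (content-+ t) (content-+ t′) (+-mono-≤ le (<⇒≤ (≰⇒> ≰))))

  -- Hence a factor of the residue word, which keeps only the contents of the cells containing a
  -- letter, still determines those cells.
  key-injective : ∀ {e e′} → InT e → InT e′ → key e ≡ key e′ → e ≡ e′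
  key-injective {e} {e′} t t′ eq = InT-unique t t′ rows cols (cong proj₁ eq)
    where
    rows : row e ≡ row e′
    rows = ≤-antisym (content-≤-row t′ t (sym (cong proj₁ eq)) (≤-reflexive (sym (cong proj₂ eq))))
                     (content-≤-row t t′ (cong proj₁ eq) (≤-reflexive (cong proj₂ eq)))
    cols : col e ≡ col e′
    cols = +-cancelˡ-≡ ℓ _ _ (trans (sym (content-+ t)) (trans (cong₂ _+_ (cong proj₂ eq) rows) (content-+ t′)))

  _>ₖ_ : Event → Event → Set
  e′ >ₖ e = key e′ >ₗ key e

  >ₖ⇒≻ : ∀ {e′ e} → InT e′ → InT e → e′ >ₖ e → e′ ≻ e
  >ₖ⇒≻ t′ t (inj₁ lt) = lab< lt
  >ₖ⇒≻ {e′} {e} t′ t (inj₂ (leq , lt)) with m≤n⇒m<n∨m≡n (content-≤-row t t′ leq (<⇒≤ lt))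
  ... | inj₁ r = row< leq r
  ... | inj₂ req = row≡ leq req (isNew e′ t′ leq req (content-<-col t t′ (sym req) lt))
    where
    isNew : ∀ e′ → InT e′ → lab e ≡ lab e′ → row e′ ≡ row e → col e < col e′ → IsNew e′
    isNew (new k i j) t′ leq req lt = tt
    -- If `k` were not the least entry of its cell, the least one would be smaller than the same
    -- label in a cell further left.
    isNew (mul k i j) (c′ , at′ , e′∈) leq refl lt with mul-min (kind at′) e′∈
    ... | k₀ , k₀<k , new∈ = <⇒≱ k₀<k (≤-trans (≤-reflexive (sym leq))
            (right-≤ lt (proj₁ (proj₂ t)) at′ (InT-lab t) (proj₂ (proj₂ (cellEvents⁻ c′ new∈)))))

  -- Along a row entries weakly increase, so comparing labels before contents agrees with comparing
  -- columns before labels.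
  same-row-▷ : ∀ {x y} → InT x → InT y → row x ≡ row y → x >ₖ y → x ▷ y
  same-row-▷ {x} {y} tx ty req gt with <-cmp (col y) (col x)
  ... | tri< lt _ _ = inj₁ lt
  same-row-▷ {x} {y} tx ty req (inj₁ lt) | tri≈ _ ceq _ = inj₂ (ceq , lt)
  same-row-▷ {x} {y} tx ty req (inj₂ (_ , lt)) | tri≈ _ ceq _ = ⊥-elim (<-irrefl ceq (content-<-col ty tx (sym req) lt))
  same-row-▷ {x} {y} tx ty req (inj₂ (_ , lt)) | tri> _ _ gt = ⊥-elim (<-asym gt (content-<-col ty tx (sym req) lt))
  same-row-▷ {x} {y} tx ty req (inj₁ lt) | tri> _ _ gt = ⊥-elim (<⇒≱ lt (lab-≤ tx ty req gt))
    where
    lab-≤ : ∀ {x y} → InT x → InT y → row x ≡ row y → col x < col y → lab x ≤ lab y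
    lab-≤ tx ty@(c , at , y∈) req lt = right-≤ lt (proj₁ (proj₂ tx)) (subst (λ i → At i _ c) (sym req) at)
      (InT-lab tx) (subst (λ i → _ ∈ entries i c) (sym req) (InT-lab ty))

  W : List (ℕ × ℕ)
  W = let h = res m ℓ T ++ res n ℓ (Tmu mu) in labelled (length h) h

  private
    hT hM : ℕ → List ℕ
    hT k = hfactor (allCells ℓ 0 T) (suc k)
    hM k = hfactor (allCells ℓ 0 (Tmu mu)) (suc k)

    length-res : length (res m ℓ T ++ res n ℓ (Tmu mu)) ≡ m + n
    length-res = trans (length-++ (res m ℓ T))
      (cong₂ _+_ (trans (length-map hT (downFrom m)) (length-downFrom m))
                 (trans (length-map hM (downFrom n)) (length-downFrom n)))

    W-≡ : W ≡ labelled (m + n) (map hT (downFrom m) ++ res n ℓ (Tmu mu))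
    W-≡ = cong (λ k → labelled k (res m ℓ T ++ res n ℓ (Tmu mu))) length-res

    Wμ-≡ : labelled n (res n ℓ (Tmu mu)) ≡ labelled (n + 0) (map hM (downFrom n) ++ [])
    Wμ-≡ = cong₂ labelled (sym (+-identityʳ n)) (sym (++-identityʳ (res n ℓ (Tmu mu))))

  W-sorted : AllPairs _>ₗ_ W
  W-sorted = labelled-sorted _ _ ≤-refl (Allₚ.++⁺
    (Allₚ.map⁺ (All.universal (λ k → hfactor-sorted (allCells ℓ 0 T) (suc k)) (downFrom m)))
    (Allₚ.map⁺ (All.universal (λ k → hfactor-sorted (allCells ℓ 0 (Tmu mu)) (suc k)) (downFrom n))))

  private
    witness : ∀ {i j c k} → At i j c → k ∈ entries i c → ∃ λ e → InT e × key e ≡ (k , (ℓ + j) ∸ i)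
    witness {i} {j} {c} at k∈ with cellEvents⁺ {i} {j} c k∈
    ... | e , e∈ , refl with cellEvents⁻ c e∈
    ...   | refl , refl , _ = e , InT⁺ at e∈ , refl

  W⁻ : ∀ {p} → p ∈ W → ∃ λ e → InT e × key e ≡ p
  W⁻ {q , c} p∈ with ∈-labelled⁻ n hT (res n ℓ (Tmu mu)) m (subst ((q , c) ∈_) W-≡ p∈)
  ... | inj₁ (k , k<m , refl , c∈) with ∈-hfactor⁻ (allCells ℓ 0 T) (suc k) c∈
  ...   | s , cs∈ , k∈s with ∈-allCells⁻ ℓ 0 T cs∈
  ...     | i , j , at , refl = witness at (∈-map⁺ (_+ n) k∈s)
  W⁻ {q , c} p∈ | inj₂ p∈μ with ∈-labelled⁻ 0 hM [] n (subst ((q , c) ∈_) Wμ-≡ p∈μ)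
  ... | inj₁ (k , k<n , refl , c∈) with ∈-hfactor⁻ (allCells ℓ 0 (Tmu mu)) (suc k) c∈
  ...   | s , cs∈ , k∈s with ∈-allCells⁻ ℓ 0 (Tmu mu) cs∈
  ...     | i , j , atμ , refl with tmuRows⁻ 0 mu i j atμ
  W⁻ p∈ | inj₂ p∈μ | inj₁ (k , k<n , refl , c∈) | _ , cs∈ , here refl | i , j , atμ , refl | j< , refl
    with At-exists (<-≤-trans j< (proj₂ sub i))
  ... | c , at with kind at
  ...   | inside _ = witness at (here (+-identityʳ (suc i)))
  ...   | outside le _ = ⊥-elim (<⇒≱ j< le)

  W⁺ : ∀ {e} → InT e → key e ∈ W
  W⁺ {e} t@(c , at , _) = subst (key e ∈_) (sym W-≡) (go (kind at) at (InT-lab t))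
    where
    go : ∀ {i j k c} → Kind i j c → At i j c → k ∈ entries i c →
         (k , (ℓ + j) ∸ i) ∈ labelled (m + n) (map hT (downFrom m) ++ res n ℓ (Tmu mu))
    go {i} {j} (inside lt) at (here refl) = ∈-labelled⁺ʳ n hT (res n ℓ (Tmu mu)) m
      (subst ((suc i , (ℓ + j) ∸ i) ∈_) (sym Wμ-≡) (subst (λ z → (z , (ℓ + j) ∸ i) ∈ labelled (n + 0) (map hM (downFrom n) ++ []))
        (+-identityʳ (suc i)) (∈-labelled⁺ˡ 0 hM [] n (part-< mu i lt)
          (∈-hfactor⁺ _ (suc i) (∈-allCells⁺ ℓ 0 (Tmu mu) i j (tmuRows⁺ 0 mu i lt)) (here refl)))))
    go {i} {j} (outside _ (_ , _ , ps)) at k∈ with ∈-map⁻ (_+ n) k∈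
    ... | b , b∈ , refl with b | All.lookup ps b∈ | b∈
    ...   | suc b | (_ , b<m) | b∈ = ∈-labelled⁺ˡ n hT (res n ℓ (Tmu mu)) m b<m
            (∈-hfactor⁺ _ (suc b) (∈-allCells⁺ ℓ 0 T i j at) b∈)

  private
    collect : ∀ {ps} → All (λ p → ∃ λ e → InT e × key e ≡ p) ps → ∃ λ L → map key L ≡ ps × All InT L
    collect [] = [] , refl , []
    collect ((e , t , refl) ∷ ps) with collect ps
    ... | L , refl , ts = e ∷ L , refl , t ∷ ts

    collected = collect (All.tabulate W⁻)

  abstract
    events : List Event
    events = proj₁ collected

    events-key : map key events ≡ W
    events-key = proj₁ (proj₂ collected)

    events-InT : All InT events
    events-InT = proj₂ (proj₂ collected)

  events-sorted : AllPairs _>ₖ_ events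
  events-sorted = AllPairsₚ.map⁻ (subst (AllPairs _>ₗ_) (sym events-key) W-sorted)

  ∈-events : ∀ {e} → InT e → e ∈ events
  ∈-events {e} t with ∈-map⁻ key (subst (key e ∈_) (sym events-key) (W⁺ t))
  ... | e′ , e′∈ , eq = subst (_∈ events) (sym (key-injective t (All.lookup events-InT e′∈) eq)) e′∈

  events-Ordered : Ordered events
  events-Ordered = AllPairs-zip >ₖ⇒≻ events-InT events-sorted

  -- The new cells of a final segment of the reading order fill each row from the
  -- left.
  record Counted (L : List Event) : Set where
    field
      count⁻ : ∀ {i j} → j < ν L i → ∃ λ k → new k i j ∈ L
      count⁺ : ∀ {i j k} → new k i j ∈ L → j < ν L i

  Lower : List Event → Set
  Lower L = ∀ {x y} → InT x → y ∈ L → y >ₖ x → x ∈ L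

  private
    >ₖ-asym : ∀ {x y} → x >ₖ y → ¬ y >ₖ x
    >ₖ-asym {x} {y} = >ₗ-asym (key x) (key y)

    lower-tail : ∀ {e L} → All (e >ₖ_) L → Lower (e ∷ L) → Lower L
    lower-tail {e} gts low {x} {y} t y∈ gt with low t (there y∈) gt
    ... | there x∈ = x∈
    ... | here refl = ⊥-elim (>ₖ-asym {y} {e} gt (All.lookup gts y∈))

    lower-head : ∀ {e L} → Lower (e ∷ L) → ∀ {x} → InT x → e >ₖ x → x ∈ L
    lower-head {e} low t gt with low t (here refl) gt
    ... | there x∈ = x∈
    ... | here refl = ⊥-elim (>ₖ-asym {e} {e} gt gt)

    lab-≤-col-<⇒>ₖ : ∀ {e x} → InT e → InT x → row x ≡ row e → col x < col e → lab x ≤ lab e → e >ₖ x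
    lab-≤-col-<⇒>ₖ {e} {x} te tx req lt le with m≤n⇒m<n∨m≡n le
    ... | inj₁ l = inj₁ l
    ... | inj₂ leq = inj₂ (leq , +-cancelʳ-< (row e) _ _
            (subst₂ _<_ (sym (trans (cong (content ℓ x +_) (sym req)) (content-+ tx))) (sym (content-+ te)) (+-monoʳ-< ℓ lt)))

  -- What must already be there, namely the cells to the left and below and the least entry of an
  -- occupied cell, is read earlier and so lies in `L` by `Lower`. What must not be there, the cell
  -- above an addition or the opened cell itself, would be read later than or at the same time as
  -- `e`, whereas all of `L` is read strictly before. `Counted` turns membership into row lengths.
  valid-counted : ∀ L → All InT L → AllPairs _>ₖ_ L → Lower L → Valid ℓ L × Counted L
  valid-counted [] [] [] low = [] , record { count⁻ = λ () ; count⁺ = λ () }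
  valid-counted (e ∷ L) (t ∷ ts) (gts ∷ gs) low with valid-counted L ts gs (lower-tail gts low)
  valid-counted (mul k i j ∷ L) (t@(c , at , e∈) ∷ ts) (gts ∷ gs) low | v , cnt =
    ((col≥ , col< , At-row at) ∷ v) , record
      { count⁻ = λ lt → map₂ there (count⁻ lt) ; count⁺ = λ { (there n∈) → count⁺ n∈ } }
    where
    open Counted cnt
    col< : j < ν L i
    col< with mul-min (kind at) e∈
    ... | k₀ , k₀<k , new∈ = count⁺ (lower-head low (c , at , new∈) (inj₁ k₀<k))
    col≥ : ν L (suc i) ≤ j
    col≥ with ν L (suc i) ≤? j
    ... | yes le = le
    ... | no ≰ with count⁻ (≰⇒> ≰)
    ...   | k′ , k′∈ = ⊥-elim (>ₖ-asym {mul k i j} {new k′ (suc i) j} (All.lookup gts k′∈)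
              (inj₁ (up-< (n<1+n i) at (proj₁ (proj₂ t′)) (InT-lab t) (InT-lab t′))))
      where
      t′ = All.lookup ts k′∈
  valid-counted (new k i j ∷ L) (t@(c , at , e∈) ∷ ts) (gts ∷ gs) low | v , cnt =
    (ok i refl ∷ v) , record { count⁻ = cnt⁻ ; count⁺ = cnt⁺ }
    where
    open Counted cnt
    left : ∀ {j′} → j′ < j → j′ < ν L i
    left lt with At-closed ≤-refl (<⇒≤ lt) at
    ... | c′ , at′ with cellEvents-new (kind at′)
    ...   | k′ , new∈ = count⁺ (lower-head low (c′ , at′ , new∈)
              (lab-≤-col-<⇒>ₖ t (c′ , at′ , new∈) refl lt
                (right-≤ lt at′ at (proj₂ (proj₂ (cellEvents⁻ c′ new∈))) (InT-lab t))))
    ≤ν : j ≤ ν L i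
    ≤ν with j ≤? ν L i
    ... | yes le = le
    ... | no ≰ = ⊥-elim (<-irrefl refl (left (≰⇒> ≰)))
    ≥ν : ν L i ≤ j
    ≥ν with ν L i ≤? j
    ... | yes le = le
    ... | no ≰ with count⁻ (≰⇒> ≰)
    ...   | k′ , k′∈ with All.lookup ts k′∈
    ...     | c′ , at′ , new∈ with just-injective (trans (sym at) at′)
    ...       | refl with new-unique c e∈ new∈
    ...         | refl = ⊥-elim (>ₖ-asym {new k i j} {new k i j} (All.lookup gts k′∈) (All.lookup gts k′∈))
    j≡ν : j ≡ ν L i
    j≡ν = ≤-antisym ≤ν ≥ν
    ok : ∀ i′ → i ≡ i′ → Ok ℓ (ν L) (new k i′ j)
    ok zero refl = j≡ν , At-row at
    ok (suc i′) refl = j≡ν , At-row at , subst (_< ν L i′) j≡ν below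
      where
      below : j < ν L i′
      below with At-closed (n≤1+n i′) ≤-refl at
      ... | c′ , at′ with cellEvents-new (kind at′)
      ...   | k′ , new∈ = count⁺ (lower-head low (c′ , at′ , new∈)
                (inj₁ (up-< (n<1+n i′) at′ at (proj₂ (proj₂ (cellEvents⁻ c′ new∈))) (InT-lab t))))
    cnt⁻ : ∀ {i′ j′} → j′ < ν (new k i j ∷ L) i′ → ∃ λ k′ → new k′ i′ j′ ∈ new k i j ∷ L
    cnt⁻ {i′} {j′} lt with i′ ≟ i
    ... | no ≢ = map₂ there (count⁻ (subst (j′ <_) (ν-diff k i j L ≢) lt))
    ... | yes refl with m≤n⇒m<n∨m≡n (s≤s⁻¹ (subst (j′ <_) (ν-same k i j L) lt))
    ...   | inj₁ lt′ = map₂ there (count⁻ lt′)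
    ...   | inj₂ eq = k , here (cong (new k i) (trans eq (sym j≡ν)))
    cnt⁺ : ∀ {i′ j′ k′} → new k′ i′ j′ ∈ new k i j ∷ L → j′ < ν (new k i j ∷ L) i′
    cnt⁺ (here refl) = ≤-trans (s≤s ≤ν) (≤-reflexive (sym (ν-same k i j L)))
    cnt⁺ {i′} {j′} (there n∈) with i′ ≟ i
    ... | no ≢ = subst (j′ <_) (sym (ν-diff k i j L ≢)) (count⁺ n∈)
    ... | yes refl = subst (j′ <_) (sym (ν-same k i j L)) (m≤n⇒m≤1+n (count⁺ n∈))

  events-Valid : Valid ℓ events
  events-Valid = proj₁ (valid-counted events events-InT events-sorted (λ t _ _ → ∈-events t))

  -- Recovering the rows of `T` from its events

  rowEvents : ℕ → ℕ → Row → List Event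
  rowEvents i j [] = []
  rowEvents i j (c ∷ cs) = rowEvents i (suc j) cs ++ cellEvents i j c

  rowEvents⁻ : ∀ i j cs {e} → e ∈ rowEvents i j cs → ∃ λ p → ∃ λ c → nthM cs p ≡ just c × e ∈ cellEvents i (j + p) c
  rowEvents⁻ i j (c ∷ cs) {e} e∈ with ∈-++⁻ (rowEvents i (suc j) cs) e∈
  ... | inj₂ e∈c = 0 , c , refl , subst (λ z → e ∈ cellEvents i z c) (sym (+-identityʳ j)) e∈c
  ... | inj₁ e∈cs with rowEvents⁻ i (suc j) cs e∈cs
  ...   | p , c′ , eq , e∈c = suc p , c′ , eq , subst (λ z → e ∈ cellEvents i z c′) (sym (+-suc j p)) e∈c

  rowEvents⁺ : ∀ i j cs p {c e} → nthM cs p ≡ just c → e ∈ cellEvents i (j + p) c → e ∈ rowEvents i j cs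
  rowEvents⁺ i j (c ∷ cs) zero {e = e} refl e∈ =
    ∈-++⁺ʳ (rowEvents i (suc j) cs) (subst (λ z → e ∈ cellEvents i z c) (+-identityʳ j) e∈)
  rowEvents⁺ i j (_ ∷ cs) (suc p) {c} {e} eq e∈ =
    ∈-++⁺ˡ (rowEvents⁺ i (suc j) cs p eq (subst (λ z → e ∈ cellEvents i z c) (+-suc j p) e∈))

  rowEvents-sorted : ∀ i j cs → (∀ p c → nthM cs p ≡ just c → Kind i (j + p) c) → AllPairs _▷_ (rowEvents i j cs)
  rowEvents-sorted i j [] ks = []
  rowEvents-sorted i j (c ∷ cs) ks = AllPairsₚ.++⁺
    (rowEvents-sorted i (suc j) cs (λ p c eq → subst (λ z → Kind i z c) (+-suc j p) (ks (suc p) c eq)))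
    (cellEvents-sorted (subst (λ z → Kind i z c) (+-identityʳ j) (ks 0 c refl)))
    (All.tabulate λ e′∈ → All.tabulate λ e∈ → inj₁ (right e′∈ e∈))
    where
    right : ∀ {e′ e} → e′ ∈ rowEvents i (suc j) cs → e ∈ cellEvents i j c → col e < col e′
    right e′∈ e∈ with rowEvents⁻ i (suc j) cs e′∈
    ... | p , c′ , _ , e′∈c rewrite proj₁ (proj₂ (cellEvents⁻ c′ e′∈c)) | proj₁ (proj₂ (cellEvents⁻ c e∈)) = s≤s (m≤m+n j p)

  onRow-events : ∀ i → onRow i events ≡ rowEvents i 0 (rowAt T i)
  onRow-events i = AllPairs-unique {R = _▷_} (λ {x} {y} → ▷-asym {x} {y}) sorted (rowEvents-sorted i 0 (rowAt T i) (λ p c → kind)) to from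
    where
    sorted : AllPairs _▷_ (onRow i events)
    sorted = AllPairs-zip (λ (tx , rx) (ty , ry) → same-row-▷ tx ty (trans (sym rx) ry))
      (All.tabulate (λ {e} e∈ → let (e∈′ , r) = ∈-filter⁻ (λ e → i ≟ row e) {xs = events} e∈ in All.lookup events-InT e∈′ , r))
      (AllPairsₚ.filter⁺ (λ e → i ≟ row e) events-sorted)
    to : ∀ {e} → e ∈ onRow i events → e ∈ rowEvents i 0 (rowAt T i)
    to {e} e∈ with ∈-filter⁻ (λ e → i ≟ row e) {xs = events} e∈
    ... | e∈′ , refl with All.lookup events-InT e∈′
    ...   | c , at , e∈c = rowEvents⁺ i 0 (rowAt T i) (col e) at e∈c
    from : ∀ {e} → e ∈ rowEvents i 0 (rowAt T i) → e ∈ onRow i events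
    from e∈ with rowEvents⁻ i 0 (rowAt T i) e∈
    ... | p , c , at , e∈c = ∈-filter⁺ (λ e → i ≟ row e) (∈-events (InT⁺ at e∈c)) (sym (proj₁ (cellEvents⁻ c e∈c)))

  data Good (i : ℕ) : Cell → Set where
    inside : i < n → Good i nothing
    outside : ∀ {a s} → All (1 ≤_) (a ∷ s) → Good i (just (a ∷ s))

  good : ∀ {i j c} → Kind i j c → Good i c
  good {i} (inside lt) = inside (part-< mu i lt)
  good (outside _ (_ , _ , ps)) = outside (All.map proj₁ ps)

  goodRow : ∀ i → All (Good i) (rowAt T i)
  goodRow i = nthM-All (rowAt T i) (λ j c at → good (kind at))

  private
    unshift : ∀ s → map (_∸ n) (map (_+ n) s) ≡ s
    unshift s = trans (sym (map-∘ s)) (trans (map-cong (λ x → m+n∸n≡m x n) s) (map-id s))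

    news-mul : ∀ i j s → news i (map (λ b → mul (b + n) i j) s) ≡ []
    news-mul i j [] = refl
    news-mul i j (b ∷ s) = news-mul i j s

    muls-mul : ∀ i j s → muls i (map (λ b → mul (b + n) i j) s) ≡ map (_+ n) s
    muls-mul i j [] = refl
    muls-mul i j (b ∷ s) rewrite ≡ᵇ-refl i = cong (b + n ∷_) (muls-mul i j s)

    news-cell : ∀ {i j c} → Good i c → map (_∸ n) (news i (cellEvents i j c)) ≡ [ encode c ]
    -- The entry `suc i` is at most `n` and truncates to 0, the code of a cell of `mu`.
    news-cell {i} (inside lt) rewrite ≡ᵇ-refl i = cong [_] (m≤n⇒m∸n≡0 lt)
    news-cell {i} {j} (outside {a} {s} _)
      rewrite news-++ i (map (λ b → mul (b + n) i j) (reverse s)) [ new (a + n) i j ]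
            | news-mul i j (reverse s) | ≡ᵇ-refl i = cong [_] (m+n∸n≡m a n)

    muls-cell : ∀ {i j c} → Good i c → muls i (cellEvents i j c) ≡ map (_+ n) (extras c)
    muls-cell {i} (inside lt) = refl
    muls-cell {i} {j} (outside {a} {s} _)
      rewrite muls-++ i (map (λ b → mul (b + n) i j) (reverse s)) [ new (a + n) i j ]
            | muls-mul i j (reverse s) = ++-identityʳ _

    news-row : ∀ {i cs} j → All (Good i) cs → map (_∸ n) (news i (rowEvents i j cs)) ≡ map encode cs
    news-row j [] = refl
    news-row {i} {c ∷ cs} j (g ∷ gs) rewrite news-++ i (rowEvents i (suc j) cs) (cellEvents i j c)
      | map-++ (_∸ n) (news i (cellEvents i j c)) (news i (rowEvents i (suc j) cs))
      | news-cell {i} {j} g = cong (encode c ∷_) (news-row (suc j) gs)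

    muls-row : ∀ {i cs} j → All (Good i) cs → muls i (rowEvents i j cs) ≡ map (_+ n) (rowExtras cs)
    muls-row j [] = refl
    muls-row {i} {c ∷ cs} j (g ∷ gs) rewrite muls-++ i (rowEvents i (suc j) cs) (cellEvents i j c)
      | muls-cell {i} {j} g | muls-row (suc j) gs = sym (map-++ (_+ n) (rowExtras cs) (extras c))

  news-events : ∀ i → map (_∸ n) (news i events) ≡ map encode (rowAt T i)
  news-events i = trans (cong (map (_∸ n)) (trans (sym (news-onRow i events)) (cong (news i) (onRow-events i))))
                        (news-row 0 (goodRow i))

  muls-events : ∀ i → muls i events ≡ map (_+ n) (rowExtras (rowAt T i))
  muls-events i = trans (sym (muls-onRow i events)) (trans (cong (muls i) (onRow-events i)) (muls-row 0 (goodRow i)))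

  extras-positive : ∀ {i c} → Good i c → All (1 ≤_) (extras c)
  extras-positive (inside _) = []
  extras-positive (outside (_ ∷ ps)) = reverse⁺ ps

  rowExtras-positive : ∀ {i cs} → All (Good i) cs → All (1 ≤_) (rowExtras cs)
  rowExtras-positive [] = []
  rowExtras-positive (g ∷ gs) = Allₚ.++⁺ (rowExtras-positive gs) (extras-positive g)

  good-WellFormed : ∀ {i c} → Good i c → WellFormed c
  good-WellFormed (inside _) = tt
  good-WellFormed (outside (p ∷ _)) = p

  uncrowdable : All (λ r → All (1 ≤_) (rowExtras r) × All WellFormed r) T
  uncrowdable = nthD-All T (λ i → rowExtras-positive (goodRow i) , All.map good-WellFormed (goodRow i))

  rows-Padded : ∀ i → Padded (part mu i) (map encode (rowAt T i))
  rows-Padded i = go (part mu i) (rowAt T i) (subst (part mu i ≤_) (sym (rowlen i)) (proj₂ sub i)) (λ j c at → cell at)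
    where
    cell : ∀ {j c} → At i j c → (j < part mu i × c ≡ nothing) ⊎ (part mu i ≤ j × 1 ≤ encode c)
    cell at with kind at
    ... | inside lt = inj₁ (lt , refl)
    ... | outside le (_ , _ , ((p , _) ∷ _)) = inj₂ (le , p)
    go : ∀ a cs → a ≤ length cs →
         (∀ j c → nthM cs j ≡ just c → (j < a × c ≡ nothing) ⊎ (a ≤ j × 1 ≤ encode c)) → Padded a (map encode cs)
    go zero cs le h = padded (map encode cs) refl (Allₚ.map⁺ (nthM-All cs λ j c eq → pos (h j c eq)))
      where
      pos : ∀ {j c} → (j < 0 × c ≡ nothing) ⊎ (0 ≤ j × 1 ≤ encode c) → 1 ≤ encode c
      pos (inj₂ (_ , p)) = p
    go (suc a) (c ∷ cs) (s≤s le) h with h 0 c refl | go a cs le (λ j c eq → shift (h (suc j) c eq))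
      where
      shift : ∀ {j c} → (suc j < suc a × c ≡ nothing) ⊎ (suc a ≤ suc j × 1 ≤ encode c) →
              (j < a × c ≡ nothing) ⊎ (a ≤ j × 1 ≤ encode c)
      shift (inj₁ (s≤s lt , eq)) = inj₁ (lt , eq)
      shift (inj₂ (s≤s le , p)) = inj₂ (le , p)
    ... | inj₁ (_ , refl) | padded N eq ps = padded N (cong (0 ∷_) eq) ps

  -- Comparison of the recording tableau with the uncrowding

  uncrowded : ℕ → List ℕ
  uncrowded i = rowAfter i (map encode ∘ rowAt T) (rowExtras ∘ rowAt T)

  Q* : List (List ℕ)
  Q* = proj₂ (starInsert (res m ℓ T ++ res n ℓ (Tmu mu)))

  Q*-row : ∀ i → map (_∸ n) (nthD [] Q* i) ≡ uncrowded i
  Q*-row i = trans (cong (map (_∸ n)) Q*-level)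
    (trans (sym (rowAfter-map n i (λ i → news i events) (λ i → muls i events) muls-≥))
    (rowAfter-cong i news-events (λ i → trans (cong (map (_∸ n)) (muls-events i)) (unshift _))))
    where
    Q*-level : nthD [] Q* i ≡ rowAfter i (λ i → news i events) (λ i → muls i events)
    Q*-level = trans (cong (λ w → nthD [] (proj₂ (insertWord ℓ w)) i) (sym events-key))
      (trans (recording-row ℓ i events-Valid) (sym (rowAfter-level i events-Ordered)))
    muls-≥ : ∀ i → All (n ≤_) (muls i events)
    muls-≥ i = subst (All (n ≤_)) (sym (muls-events i)) (Allₚ.map⁺ (All.universal (m≤n+m n) _))

  tildeStar-Q : ∀ i j → proj₂ (tildeStar lam mu (res m ℓ T)) i j ≡
                (if j <ᵇ part mu i then nothing else Maybe.map (_∸ n) (nthM (nthD [] Q* i) j))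
  tildeStar-Q i j with j <ᵇ part mu i
  ... | true = refl
  ... | false with nthM (nthD [] Q* i) j
  ...   | nothing = refl
  ...   | just q = refl

  Q≡uncrowdP : ∀ i j → proj₂ (tildeStar lam mu (res m ℓ T)) i j ≡ uncrowdP T i j
  Q≡uncrowdP i j = begin
    proj₂ (tildeStar lam mu (res m ℓ T)) i j
      ≡⟨ tildeStar-Q i j ⟩
    (if j <ᵇ part mu i then nothing else Maybe.map (_∸ n) (nthM (nthD [] Q* i) j))
      ≡⟨ cong (λ v → if j <ᵇ part mu i then nothing else v)
              (trans (sym (nthM-map (_∸ n) (nthD [] Q* i) j)) (cong (λ X → nthM X j) (Q*-row i))) ⟩
    (if j <ᵇ part mu i then nothing else nthM (uncrowded i) j)
      -- The zeros fill exactly the first `part mu i` places, so deleting the cells of `mu` and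
      -- reading 0 as an absent cell come to the same.
      ≡⟨ sym (nthM-Padded j (rowAfter-Padded i {part mu} rows-Padded (λ i → rowExtras-positive (goodRow i)))) ⟩
    positive (nthM (uncrowded i) j)
      ≡⟨ sym (uncrowdP-rowAfter T uncrowdable i j) ⟩
    uncrowdP T i j ∎
    where open ≡-Reasoning

theorem4p29 : (m : ℕ) (lam mu : Partition) → IsPartition lam → IsPartition mu → mu ⊆ₚ lam →
    (T : Tab) → IsSVT m lam mu T →
    ∀ i j → proj₂ (tildeStar lam mu (res m (length lam) T)) i j ≡ uncrowdP T i j
theorem4p29 m lam mu lamP muP sub T svt = Events.Q≡uncrowdP lamP muP sub svt
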